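{- Let $R$ be a commutative ring and let $A=\bigoplus_{i\in\mathbb{Z}}A_i$ be a commutative, graded $R$-algebra with identity such that each $A_i$ is free of finite rank. For any finite graph $G=(V,E)$, and any fixed ordering of the edge set $E$, \[H^*(F^{\mathrm{Ch}})\cong H^*(F^{\mathrm{Ch}}|_{\mathrm{NBC}}),\] where $F^{\mathrm{Ch}}=F^{\mathrm{Ch}}_{G,A}:2^E\to R\text{ - }\mathbf{gmod}$ is the chromatic functor.
   Context: A finite graph $G=(V,E)$ consists of a finite set $V$ and a set $E$ of 2-element subsets of $V$. A cycle is (the edge set of) a closed sequence $x_1,\dots,x_k,x_1$ with $k\ge 3$, $x_1,\dots,x_k$ distinct vertices and each $\{x_i,x_{i+1}\}$ an edge (indices mod $k$). Fix an ordering $e_1,\dots,e_m$ of $E$. A broken circuit is a set $C\setminus\{e\}$ where $C\subseteq E$ is a cycle and $e$ is the edge of $C$ with the largest label. $\mathrm{NBC}$ is the set of all $S\subseteq E$ that contain no broken circuit; it is a lower order ideal of the Boolean lattice $2^E$ (subsets of $E$ ordered by inclusion). $R\text{ - }\mathbf{gmod}$ is the category of graded $R$-modules and degree-preserving homomorphisms. For $S\subseteq E$, $k(S)$ is the number of connected components of the spanning subgraph with vertex set $V$ and edge set $S$. The chromatic functor $F^{\mathrm{Ch}}=F^{\mathrm{Ch}}_{G,A}$ on the poset $2^E$ (viewed as a category) is given by: $F^{\mathrm{Ch}}(S)=A^{\otimes k(S)}$ (tensor product over $R$, one factor for each connected component of $S$); for a cover relation $S\lessdot S\cup\{e\}$,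 if $e$ joins two distinct components of $S$, then $F^{\mathrm{Ch}}(S\lessdot S\cup\{e\})$ multiplies the two tensor factors of $A$ corresponding to those components, and if $e$ completes a cycle, it is the identity map. Let $c(S\lessdot S\cup\{e_i\})=(-1)^{\#\{e_j\in S\,:\,j<i\}}$. For a lower order ideal $Q$ of $2^E$ (in particular $Q=2^E$ or $Q=\mathrm{NBC}$), $H^*(F^{\mathrm{Ch}}|_Q)$ is the cohomology of the cochain complex with $C^k=\bigoplus_{S\in Q,\,|S|=k}F^{\mathrm{Ch}}(S)$ and differential $\delta^k=\sum c(S\lessdot T)F^{\mathrm{Ch}}(S\lessdot T)$, summed over cover relations $S\lessdot T$ in $Q$ with $|S|=k$. -}

module Defs where

open import Level using (Level; _⊔_; 0ℓ; Lift; lift) renaming (suc to lsuc)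
open import Function.Base using (_∘_; id)
open import Function.Bundles using (_⇔_)
open import Function.Definitions using (Injective)
open import Data.Unit.Base using (tt) renaming (⊤ to Unit)
open import Data.Product.Base using (Σ; ∃; ∃₂; _×_; _,_; proj₁; proj₂)
open import Data.Sum.Base using (_⊎_; inj₁; inj₂; [_,_]′; swap)
open import Data.Nat.Base as ℕ using (ℕ; zero; suc)
import Data.Nat.Properties as ℕₚ
open import Data.Nat.DivMod using (_mod_)
open import Data.Integer.Base as ℤ using (ℤ; 0ℤ)
import Data.Integer.Properties as ℤₚ
open import Data.Fin.Base as Fin using (Fin; zero; suc; toℕ; punchIn; punchOut)
open import Data.Fin.Properties as Finₚ using (_≟_; _<?_; punchInᵢ≢i; punchOut-injective; punchOut-punchIn; punchOut-cong)
open import Data.Fin.Subset using (Subset; _∈_; _∉_; _⊆_; _∪_; _∩_; _-_; ⁅_⁆; ∣_∣; inside; outside)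
open import Data.Fin.Subset.Properties using (_∈?_; x∈p∪q⁺; x∈p∪q⁻; x∈⁅x⁆; x∈⁅y⁆⇒x≡y; p─q⊆p; p─⊥≡p; x∈p∧x≢y⇒x∈p-y; ⊆-antisym; ⊆-trans; ∪-identityʳ)
open import Data.Vec.Base using (tabulate; []; _∷_; here; there)
open import Relation.Nullary using (¬_; Dec; yes; no; does; contradiction)
open import Relation.Binary.Core using (Rel)
open import Relation.Binary.PropositionalEquality as ≡ using (_≡_; _≢_; refl; cong; subst)
open import Relation.Binary.Construct.Closure.ReflexiveTransitive as Star using (Star; ε; _◅_; _◅◅_)
import Relation.Binary.Reasoning.Setoid as SetoidReasoning
open import Algebra.Bundles using (CommutativeMonoid; CommutativeRing)
open import Algebra.Module.Bundles using (Module; LeftModule)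
open import Algebra.Module.Structures.Biased using (module IsModuleFromLeft)
open import Algebra.Module.Morphism.Structures using (module ModuleMorphisms)
import Algebra.Properties.CommutativeMonoid.Sum as Sums
import Algebra.Properties.AbelianGroup as AbelianGroupProperties
import Algebra.Properties.CommutativeSemigroup as CommutativeSemigroupProperties
import Algebra.Properties.Semiring.Exp as SemiringExp

private
  variable
    r ℓr m ℓm n ℓn c ℓc : Level

record LinearMap {R : CommutativeRing r ℓr} (M : Module R m ℓm) (N : Module R n ℓn) :
                 Set (r ⊔ m ⊔ ℓm ⊔ n ⊔ ℓn) where
  field
    fun : Module.Carrierᴹ M → Module.Carrierᴹ N
    isModuleHomomorphism :
      ModuleMorphisms.IsModuleHomomorphism (Module.rawModule M) (Module.rawModule N) fun

  open ModuleMorphisms.IsModuleHomomorphism isModuleHomomorphism public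

infix 4 _≅_

record _≅_ {R : CommutativeRing r ℓr} (M : Module R m ℓm) (N : Module R n ℓn) :
           Set (r ⊔ m ⊔ ℓm ⊔ n ⊔ ℓn) where
  field
    fun : Module.Carrierᴹ M → Module.Carrierᴹ N
    isModuleIsomorphism :
      ModuleMorphisms.IsModuleIsomorphism (Module.rawModule M) (Module.rawModule N) fun

  open ModuleMorphisms.IsModuleIsomorphism isModuleIsomorphism public

fromLeftModule : {R : CommutativeRing r ℓr} →
                 LeftModule (CommutativeRing.ring R) m ℓm → Module R m ℓm
fromLeftModule L = record
  { isModule = IsModuleFromLeft.isModule (record { isLeftModule = isLeftModule }) }
  where open LeftModule L

module _ {R : CommutativeRing r ℓr} (M : Module R m ℓm) (N : Module R n ℓn) where
  private
    module M = Module M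
    module N = Module N

  linearMap : (f : M.Carrierᴹ → N.Carrierᴹ) →
              (∀ {x y} → x M.≈ᴹ y → f x N.≈ᴹ f y) →
              (∀ x y → f (x M.+ᴹ y) N.≈ᴹ f x N.+ᴹ f y) →
              (∀ s x → f (s M.*ₗ x) N.≈ᴹ s N.*ₗ f x) →
              LinearMap M N
  linearMap f f-cong f-+ f-* = record
    { fun = f
    ; isModuleHomomorphism = record
      { isBimoduleHomomorphism = record
        { +ᴹ-isGroupHomomorphism = record
          { isMonoidHomomorphism = record
            { isMagmaHomomorphism = record
              { isRelHomomorphism = record { cong = f-cong }
              ; homo = f-+
              }
            ; ε-homo = f-0
            }
          ; ⁻¹-homo = λ x → inverseˡ-unique (f (M.-ᴹ x)) (f x)
              (N.≈ᴹ-trans (N.≈ᴹ-sym (f-+ _ _)) (N.≈ᴹ-trans (f-cong (M.-ᴹ‿inverseˡ x)) f-0))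
          }
        ; *ₗ-homo = f-*
        ; *ᵣ-homo = λ s x → N.≈ᴹ-trans (f-cong (M.≈ᴹ-sym (M.*ₗ-*ᵣ-coincident s x)))
            (N.≈ᴹ-trans (f-* s x) (N.*ₗ-*ᵣ-coincident s (f x)))
        }
      }
    }
    where
    open AbelianGroupProperties N.+ᴹ-abelianGroup using (inverseˡ-unique; identityˡ-unique)

    f-0 : f M.0ᴹ N.≈ᴹ N.0ᴹ
    f-0 = identityˡ-unique (f M.0ᴹ) (f M.0ᴹ)
      (N.≈ᴹ-trans (N.≈ᴹ-sym (f-+ _ _)) (f-cong (M.+ᴹ-identityˡ M.0ᴹ)))

record IsFreeOfFiniteRank {R : CommutativeRing r ℓr} (M : Module R m ℓm) :
                          Set (r ⊔ ℓr ⊔ m ⊔ ℓm) where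
  open CommutativeRing R using (Carrier; _≈_; 0#)
  open Module M
  open Sums +ᴹ-commutativeMonoid using (sum)
  field
    rank        : ℕ
    basis       : Fin rank → Carrierᴹ
    spanning    : ∀ x → ∃ λ (s : Fin rank → Carrier) → x ≈ᴹ sum (λ i → s i *ₗ basis i)
    independent : ∀ (s : Fin rank → Carrier) →
                  sum (λ i → s i *ₗ basis i) ≈ᴹ 0ᴹ → ∀ i → s i ≈ 0#

record Submodule {R : CommutativeRing r ℓr} (M : Module R m ℓm) c : Set (r ⊔ m ⊔ ℓm ⊔ lsuc c) where
  open Module M
  field
    Member    : Carrierᴹ → Set c
    resp      : ∀ {x y} → x ≈ᴹ y → Member x → Member y
    0-closed  : Member 0ᴹ
    +-closed  : ∀ {x y} → Member x → Member y → Member (x +ᴹ y)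
    neg-closed : ∀ {x} → Member x → Member (-ᴹ x)
    *-closed  : ∀ s {x} → Member x → Member (s *ₗ x)

module _ {R : CommutativeRing r ℓr} {M : Module R m ℓm} {N : Module R n ℓn}
         (φ : LinearMap M N) where
  private
    module M = Module M
    module N = Module N
  open LinearMap φ
  open AbelianGroupProperties N.+ᴹ-abelianGroup using (ε⁻¹≈ε)

  kernel : Submodule M ℓn
  kernel = record
    { Member    = λ x → fun x N.≈ᴹ N.0ᴹ
    ; resp      = λ x≈y φx → N.≈ᴹ-trans (⟦⟧-cong (M.≈ᴹ-sym x≈y)) φx
    ; 0-closed  = 0ᴹ-homo
    ; +-closed  = λ φx φy → N.≈ᴹ-trans (+ᴹ-homo _ _)
                    (N.≈ᴹ-trans (N.+ᴹ-cong φx φy) (N.+ᴹ-identityˡ _))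
    ; neg-closed = λ φx → N.≈ᴹ-trans (-ᴹ-homo _) (N.≈ᴹ-trans (N.-ᴹ‿cong φx) ε⁻¹≈ε)
    ; *-closed  = λ s φx → N.≈ᴹ-trans (*ₗ-homo s _)
                    (N.≈ᴹ-trans (N.*ₗ-congˡ φx) (N.*ₗ-zeroʳ s))
    }

  image : Submodule N (m ⊔ ℓn)
  image = record
    { Member    = λ y → ∃ λ x → y N.≈ᴹ fun x
    ; resp      = λ y≈y′ (x , y≈φx) → x , N.≈ᴹ-trans (N.≈ᴹ-sym y≈y′) y≈φx
    ; 0-closed  = M.0ᴹ , N.≈ᴹ-sym 0ᴹ-homo
    ; +-closed  = λ (x , p) (x′ , p′) → x M.+ᴹ x′ ,
                    N.≈ᴹ-trans (N.+ᴹ-cong p p′) (N.≈ᴹ-sym (+ᴹ-homo x x′))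
    ; neg-closed = λ (x , p) → M.-ᴹ x , N.≈ᴹ-trans (N.-ᴹ‿cong p) (N.≈ᴹ-sym (-ᴹ-homo x))
    ; *-closed  = λ s (x , p) → s M.*ₗ x ,
                    N.≈ᴹ-trans (N.*ₗ-congˡ p) (N.≈ᴹ-sym (*ₗ-homo s x))
    }

zeroSubmodule : {R : CommutativeRing r ℓr} (M : Module R m ℓm) → ∀ c → Submodule M (ℓm ⊔ c)
zeroSubmodule M c = record
  { Member    = λ x → Lift c (x ≈ᴹ 0ᴹ)
  ; resp      = λ x≈y (lift p) → lift (≈ᴹ-trans (≈ᴹ-sym x≈y) p)
  ; 0-closed  = lift ≈ᴹ-refl
  ; +-closed  = λ (lift p) (lift q) → lift (≈ᴹ-trans (+ᴹ-cong p q) (+ᴹ-identityˡ 0ᴹ))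
  ; neg-closed = λ (lift p) → lift (≈ᴹ-trans (-ᴹ‿cong p) ε⁻¹≈ε)
  ; *-closed  = λ s (lift p) → lift (≈ᴹ-trans (*ₗ-congˡ p) (*ₗ-zeroʳ s))
  }
  where
  open Module M
  open AbelianGroupProperties +ᴹ-abelianGroup using (ε⁻¹≈ε)

-- The elements of Z, equal when they differ by an element of B; this is the
-- quotient Z / (Z ∩ B), hence Z / B as soon as B ⊆ Z.
module _ {R : CommutativeRing r ℓr} {M : Module R m ℓm}
         (Z : Submodule M c) (B : Submodule M ℓc) where
  open CommutativeRing R using (_≈_)
  open Module M
  private
    module Z = Submodule Z
    module B = Submodule B
    open AbelianGroupProperties +ᴹ-abelianGroup
      using (⁻¹-∙-comm; ⁻¹-involutive; ⁻¹-anti-homo-∙; inverseˡ-unique)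
    open CommutativeSemigroupProperties
      (CommutativeMonoid.commutativeSemigroup +ᴹ-commutativeMonoid) using (interchange)
    open SetoidReasoning ≈ᴹ-setoid

    Q : Set (m ⊔ c)
    Q = Σ Carrierᴹ Z.Member

    infix 4 _∼_
    _∼_ : Rel Q ℓc
    (x , _) ∼ (y , _) = B.Member (x +ᴹ -ᴹ y)

    ≈⇒∼ : ∀ {x y} {p : Z.Member x} {q : Z.Member y} → x ≈ᴹ y → (x , p) ∼ (y , q)
    ≈⇒∼ {x} {y} x≈y =
      B.resp (≈ᴹ-sym (≈ᴹ-trans (+ᴹ-congʳ x≈y) (-ᴹ‿inverseʳ y))) B.0-closed

    -‿swap : ∀ x y → -ᴹ (x +ᴹ -ᴹ y) ≈ᴹ y +ᴹ -ᴹ x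
    -‿swap x y = begin
      -ᴹ (x +ᴹ -ᴹ y)      ≈⟨ ⁻¹-anti-homo-∙ x (-ᴹ y) ⟩
      -ᴹ -ᴹ y +ᴹ -ᴹ x     ≈⟨ +ᴹ-congʳ (⁻¹-involutive y) ⟩
      y +ᴹ -ᴹ x           ∎

    telescope : ∀ x y z → (x +ᴹ -ᴹ y) +ᴹ (y +ᴹ -ᴹ z) ≈ᴹ x +ᴹ -ᴹ z
    telescope x y z = begin
      (x +ᴹ -ᴹ y) +ᴹ (y +ᴹ -ᴹ z)  ≈⟨ +ᴹ-assoc x _ _ ⟩
      x +ᴹ (-ᴹ y +ᴹ (y +ᴹ -ᴹ z))  ≈⟨ +ᴹ-congˡ (≈ᴹ-sym (+ᴹ-assoc _ y _)) ⟩
      x +ᴹ ((-ᴹ y +ᴹ y) +ᴹ -ᴹ z)  ≈⟨ +ᴹ-congˡ (+ᴹ-congʳ (-ᴹ‿inverseˡ y)) ⟩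
      x +ᴹ (0ᴹ +ᴹ -ᴹ z)           ≈⟨ +ᴹ-congˡ (+ᴹ-identityˡ _) ⟩
      x +ᴹ -ᴹ z                   ∎

    diff-+ : ∀ x x′ y y′ → (x +ᴹ -ᴹ x′) +ᴹ (y +ᴹ -ᴹ y′) ≈ᴹ (x +ᴹ y) +ᴹ -ᴹ (x′ +ᴹ y′)
    diff-+ x x′ y y′ =
      ≈ᴹ-trans (interchange x (-ᴹ x′) y (-ᴹ y′)) (+ᴹ-congˡ (⁻¹-∙-comm x′ y′))

    *-neg : ∀ s x → s *ₗ (-ᴹ x) ≈ᴹ -ᴹ (s *ₗ x)
    *-neg s x = inverseˡ-unique _ _
      (≈ᴹ-trans (≈ᴹ-sym (*ₗ-distribˡ s _ x)) (≈ᴹ-trans (*ₗ-congˡ (-ᴹ‿inverseˡ x)) (*ₗ-zeroʳ s)))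

    diff-* : ∀ {s t} x y → s ≈ t → s *ₗ (x +ᴹ -ᴹ y) ≈ᴹ s *ₗ x +ᴹ -ᴹ (t *ₗ y)
    diff-* {s} x y s≈t = ≈ᴹ-trans (*ₗ-distribˡ s x _)
      (+ᴹ-congˡ (≈ᴹ-trans (*-neg s y) (-ᴹ‿cong (*ₗ-congʳ s≈t))))

  subquotient : Module R (m ⊔ c) ℓc
  subquotient = fromLeftModule (record
    { Carrierᴹ = Q
    ; _≈ᴹ_ = _∼_
    ; _+ᴹ_ = λ (x , p) (y , q) → x +ᴹ y , Z.+-closed p q
    ; _*ₗ_ = λ s (x , p) → s *ₗ x , Z.*-closed s p
    ; 0ᴹ = 0ᴹ , Z.0-closed
    ; -ᴹ_ = λ (x , p) → -ᴹ x , Z.neg-closed p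
    ; isLeftModule = record
      { isLeftSemimodule = record
        { +ᴹ-isCommutativeMonoid = record
          { isMonoid = record
            { isSemigroup = record
              { isMagma = record
                { isEquivalence = record
                  { refl  = λ {x} → ≈⇒∼ {p = proj₂ x} {proj₂ x} ≈ᴹ-refl
                  ; sym   = λ d → B.resp (-‿swap _ _) (B.neg-closed d)
                  ; trans = λ d e → B.resp (telescope _ _ _) (B.+-closed d e)
                  }
                ; ∙-cong = λ d e → B.resp (diff-+ _ _ _ _) (B.+-closed d e)
                }
              ; assoc = λ { (x , p) (y , q) (z , s) →
                  ≈⇒∼ {p = Z.+-closed (Z.+-closed p q) s} {Z.+-closed p (Z.+-closed q s)}
                      (+ᴹ-assoc x y z) }
              }
            ; identity =
                (λ { (x , p) → ≈⇒∼ {p = Z.+-closed Z.0-closed p} {p} (+ᴹ-identityˡ x) })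
              , (λ { (x , p) → ≈⇒∼ {p = Z.+-closed p Z.0-closed} {p} (+ᴹ-identityʳ x) })
            }
          ; comm = λ { (x , p) (y , q) →
              ≈⇒∼ {p = Z.+-closed p q} {Z.+-closed q p} (+ᴹ-comm x y) }
          }
        ; isPreleftSemimodule = record
          { *ₗ-cong = λ {s} s≈t d → B.resp (diff-* _ _ s≈t) (B.*-closed s d)
          ; *ₗ-zeroˡ = λ { (x , p) → ≈⇒∼ {p = Z.*-closed _ p} {Z.0-closed} (*ₗ-zeroˡ x) }
          ; *ₗ-distribʳ = λ { (x , p) s t →
              ≈⇒∼ {p = Z.*-closed _ p} {Z.+-closed (Z.*-closed s p) (Z.*-closed t p)}
                  (*ₗ-distribʳ x s t) }
          ; *ₗ-identityˡ = λ { (x , p) → ≈⇒∼ {p = Z.*-closed _ p} {p} (*ₗ-identityˡ x) }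
          ; *ₗ-assoc = λ { s t (x , p) →
              ≈⇒∼ {p = Z.*-closed _ p} {Z.*-closed s (Z.*-closed t p)} (*ₗ-assoc s t x) }
          ; *ₗ-zeroʳ = λ s → ≈⇒∼ {p = Z.*-closed s Z.0-closed} {Z.0-closed} (*ₗ-zeroʳ s)
          ; *ₗ-distribˡ = λ { s (x , p) (y , q) →
              ≈⇒∼ {p = Z.*-closed s (Z.+-closed p q)}
                  {Z.+-closed (Z.*-closed s p) (Z.*-closed s q)} (*ₗ-distribˡ s x y) }
          }
        }
      ; -ᴹ‿cong = λ {x} {y} d →
          B.resp (≈ᴹ-sym (⁻¹-∙-comm (proj₁ x) (-ᴹ proj₁ y))) (B.neg-closed d)
      ; -ᴹ‿inverse =
          (λ { (x , p) → ≈⇒∼ {p = Z.+-closed (Z.neg-closed p) p} {Z.0-closed} (-ᴹ‿inverseˡ x) })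
        , (λ { (x , p) → ≈⇒∼ {p = Z.+-closed p (Z.neg-closed p)} {Z.0-closed} (-ᴹ‿inverseʳ x) })
      }
    })

-- A graded module ⊕ᵢ Mᵢ is given by its homogeneous components, and a
-- degree-preserving homomorphism by its restrictions to them.

GradedModule : CommutativeRing r ℓr → ∀ m ℓm → Set (r ⊔ ℓr ⊔ lsuc (m ⊔ ℓm))
GradedModule R m ℓm = ℤ → Module R m ℓm

GradedMap : {R : CommutativeRing r ℓr} → GradedModule R m ℓm → GradedModule R n ℓn →
            Set (r ⊔ m ⊔ ℓm ⊔ n ⊔ ℓn)
GradedMap M N = ∀ d → LinearMap (M d) (N d)

infix 4 _≅ᵍ_

_≅ᵍ_ : {R : CommutativeRing r ℓr} → GradedModule R m ℓm → GradedModule R n ℓn →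
       Set (r ⊔ m ⊔ ℓm ⊔ n ⊔ ℓn)
M ≅ᵍ N = ∀ d → M d ≅ N d

module _ {R : CommutativeRing r ℓr} (M : GradedModule R m ℓm) where
  open CommutativeRing R using (Carrier)
  private
    module M {i} = Module (M i)

  Homogeneous : Set m
  Homogeneous = ∃ λ i → M.Carrierᴹ {i}

  infix 4 _≋_

  -- Equality of homogeneous elements whose degrees agree up to _≡_ only.
  data _≋_ : Rel Homogeneous (m ⊔ ℓm) where
    same : ∀ {i} {x y : M.Carrierᴹ {i}} → x M.≈ᴹ y → (i , x) ≋ (i , y)

  data IsSum : (x y z : Homogeneous) → Set (m ⊔ ℓm) where
    isSum : ∀ {i} {x y z : M.Carrierᴹ {i}} → z M.≈ᴹ x M.+ᴹ y → IsSum (i , x) (i , y) (i , z)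

  data IsMultiple (s : Carrier) : (x z : Homogeneous) → Set (m ⊔ ℓm) where
    isMultiple : ∀ {i} {x z : M.Carrierᴹ {i}} → z M.≈ᴹ s M.*ₗ x → IsMultiple s (i , x) (i , z)

-- "Commutative" is meant without signs: x y = y x also in odd degrees.
record CommutativeGradedAlgebra (R : CommutativeRing r ℓr) m ℓm :
                                Set (r ⊔ ℓr ⊔ lsuc (m ⊔ ℓm)) where
  infixl 7 _·_
  field
    component : GradedModule R m ℓm

  open module Component {i} = Module (component i) public
    using (_≈ᴹ_; _+ᴹ_; _*ₗ_)

  A : ℤ → Set m
  A i = Module.Carrierᴹ (component i)

  private
    infix 4 _≋′_
    _≋′_ : ∀ {i j} → A i → A j → Set (m ⊔ ℓm)
    x ≋′ y = _≋_ component (_ , x) (_ , y)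

  field
    _·_         : ∀ {i j} → A i → A j → A (i ℤ.+ j)
    one         : A 0ℤ
    ·-cong      : ∀ {i j} {x x′ : A i} {y y′ : A j} → x ≈ᴹ x′ → y ≈ᴹ y′ → x · y ≈ᴹ x′ · y′
    ·-distribʳ  : ∀ {i j} (z : A j) (x y : A i) → (x +ᴹ y) · z ≈ᴹ x · z +ᴹ y · z
    ·-scaleˡ    : ∀ {i j} s (x : A i) (y : A j) → (s *ₗ x) · y ≈ᴹ s *ₗ (x · y)
    ·-assoc     : ∀ {i j k} (x : A i) (y : A j) (z : A k) → (x · y) · z ≋′ x · (y · z)
    ·-comm      : ∀ {i j} (x : A i) (y : A j) → x · y ≋′ y · x
    ·-identityˡ : ∀ {i} (x : A i) → one · x ≋′ x

∑ℤ : ∀ {k} → (Fin k → ℤ) → ℤ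
∑ℤ = Sums.sum ℤₚ.+-0-commutativeMonoid

-- The degree d part of M ⊗ ⋯ ⊗ M (k factors), presented by the tensors of
-- homogeneous elements of total degree d and the relations of multilinearity.
-- For k = 0 this is R, in degree 0.
module _ {R : CommutativeRing r ℓr} (M : GradedModule R m ℓm) where
  open CommutativeRing R using (Carrier; _≈_; _+_; _*_; 0#; 1#)

  data Tensor (k : ℕ) (d : ℤ) : Set (r ⊔ m) where
    ⨂   : (a : Fin k → Homogeneous M) → ∑ℤ (proj₁ ∘ a) ≡ d → Tensor k d
    0ᵗ  : Tensor k d
    _+ᵗ_ : Tensor k d → Tensor k d → Tensor k d
    -ᵗ_ : Tensor k d → Tensor k d
    _*ᵗ_ : Carrier → Tensor k d → Tensor k d

  infixl 6 _+ᵗ_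
  infixr 7 _*ᵗ_
  infixr 8 -ᵗ_
  infix 4 _≈ᵗ_

  data _≈ᵗ_ {k d} : Rel (Tensor k d) (r ⊔ ℓr ⊔ m ⊔ ℓm) where
    ≈refl  : ∀ {x} → x ≈ᵗ x
    ≈sym   : ∀ {x y} → x ≈ᵗ y → y ≈ᵗ x
    ≈trans : ∀ {x y z} → x ≈ᵗ y → y ≈ᵗ z → x ≈ᵗ z

    +-cong      : ∀ {x x′ y y′} → x ≈ᵗ x′ → y ≈ᵗ y′ → x +ᵗ y ≈ᵗ x′ +ᵗ y′
    +-assoc     : ∀ x y z → (x +ᵗ y) +ᵗ z ≈ᵗ x +ᵗ (y +ᵗ z)
    +-comm      : ∀ x y → x +ᵗ y ≈ᵗ y +ᵗ x
    +-identityˡ : ∀ x → 0ᵗ +ᵗ x ≈ᵗ x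
    neg-cong    : ∀ {x y} → x ≈ᵗ y → -ᵗ x ≈ᵗ -ᵗ y
    neg-inverseˡ : ∀ x → -ᵗ x +ᵗ x ≈ᵗ 0ᵗ

    *-cong      : ∀ {s t x y} → s ≈ t → x ≈ᵗ y → s *ᵗ x ≈ᵗ t *ᵗ y
    *-assoc     : ∀ s t x → (s * t) *ᵗ x ≈ᵗ s *ᵗ (t *ᵗ x)
    *-identityˡ : ∀ x → 1# *ᵗ x ≈ᵗ x
    *-distribˡ  : ∀ s x y → s *ᵗ (x +ᵗ y) ≈ᵗ s *ᵗ x +ᵗ s *ᵗ y
    *-distribʳ  : ∀ x s t → (s + t) *ᵗ x ≈ᵗ s *ᵗ x +ᵗ t *ᵗ x
    *-zeroˡ     : ∀ x → 0# *ᵗ x ≈ᵗ 0ᵗ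
    *-zeroʳ     : ∀ s → s *ᵗ 0ᵗ ≈ᵗ 0ᵗ

    ⨂-cong  : ∀ {a b p q} → (∀ c → _≋_ M (a c) (b c)) → ⨂ a p ≈ᵗ ⨂ b q
    ⨂-add   : ∀ {a b s p q t} c → IsSum M (a c) (b c) (s c) →
              (∀ c′ → c′ ≢ c → _≋_ M (s c′) (a c′) × _≋_ M (s c′) (b c′)) →
              ⨂ s t ≈ᵗ ⨂ a p +ᵗ ⨂ b q
    ⨂-scale : ∀ {a z p q} c s → IsMultiple M s (a c) (z c) →
              (∀ c′ → c′ ≢ c → _≋_ M (z c′) (a c′)) →
              ⨂ z q ≈ᵗ s *ᵗ ⨂ a p

  TensorPower : ℕ → GradedModule R (r ⊔ m) (r ⊔ ℓr ⊔ m ⊔ ℓm)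
  TensorPower k d = fromLeftModule (record
    { Carrierᴹ = Tensor k d
    ; _≈ᴹ_ = _≈ᵗ_
    ; _+ᴹ_ = _+ᵗ_
    ; _*ₗ_ = _*ᵗ_
    ; 0ᴹ = 0ᵗ
    ; -ᴹ_ = -ᵗ_
    ; isLeftModule = record
      { isLeftSemimodule = record
        { +ᴹ-isCommutativeMonoid = record
          { isMonoid = record
            { isSemigroup = record
              { isMagma = record
                { isEquivalence = record { refl = ≈refl ; sym = ≈sym ; trans = ≈trans }
                ; ∙-cong = +-cong
                }
              ; assoc = +-assoc
              }
            ; identity = +-identityˡ , λ x → ≈trans (+-comm x 0ᵗ) (+-identityˡ x)
            }
          ; comm = +-comm
          }
        ; isPreleftSemimodule = record
          { *ₗ-cong = *-cong
          ; *ₗ-zeroˡ = *-zeroˡ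
          ; *ₗ-distribʳ = *-distribʳ
          ; *ₗ-identityˡ = *-identityˡ
          ; *ₗ-assoc = *-assoc
          ; *ₗ-zeroʳ = *-zeroʳ
          ; *ₗ-distribˡ = *-distribˡ
          }
        }
      ; -ᴹ‿cong = neg-cong
      ; -ᴹ‿inverse = neg-inverseˡ , λ x → ≈trans (+-comm x (-ᵗ x)) (neg-inverseˡ x)
      }
    })

module Products {R : CommutativeRing r ℓr} (𝓐 : CommutativeGradedAlgebra R m ℓm) where
  open CommutativeGradedAlgebra 𝓐
  private
    module C {i} = Module (component i)

  H : Set m
  H = Homogeneous component

  infixl 7 _∙_
  _∙_ : H → H → H
  (i , x) ∙ (j , y) = i ℤ.+ j , x · y

  infix 4 _≈ʰ_
  _≈ʰ_ : Rel H (m ⊔ ℓm)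
  _≈ʰ_ = _≋_ component

  ≈ʰ-refl : ∀ {x} → x ≈ʰ x
  ≈ʰ-refl = same C.≈ᴹ-refl

  ≈ʰ-sym : ∀ {x y} → x ≈ʰ y → y ≈ʰ x
  ≈ʰ-sym (same p) = same (C.≈ᴹ-sym p)

  ≈ʰ-trans : ∀ {x y z} → x ≈ʰ y → y ≈ʰ z → x ≈ʰ z
  ≈ʰ-trans (same p) (same q) = same (C.≈ᴹ-trans p q)

  ∙-cong : ∀ {x x′ y y′} → x ≈ʰ x′ → y ≈ʰ y′ → x ∙ y ≈ʰ x′ ∙ y′
  ∙-cong (same p) (same q) = same (·-cong p q)

  homogeneousMonoid : CommutativeMonoid m (m ⊔ ℓm)
  homogeneousMonoid = record
    { Carrier = H
    ; _≈_ = _≈ʰ_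
    ; _∙_ = _∙_
    ; ε = 0ℤ , one
    ; isCommutativeMonoid = record
      { isMonoid = record
        { isSemigroup = record
          { isMagma = record
            { isEquivalence = record { refl = ≈ʰ-refl ; sym = ≈ʰ-sym ; trans = ≈ʰ-trans }
            ; ∙-cong = ∙-cong
            }
          ; assoc = λ (_ , x) (_ , y) (_ , z) → ·-assoc x y z
          }
        ; identity = (λ (_ , x) → ·-identityˡ x)
                   , (λ (_ , x) → ≈ʰ-trans (·-comm x one) (·-identityˡ x))
        }
      ; comm = λ (_ , x) (_ , y) → ·-comm x y
      }
    }

  open CommutativeMonoid homogeneousMonoid public using ()
    renaming (ε to 1ʰ; comm to ∙-comm; identityˡ to ∙-identityˡ; identityʳ to ∙-identityʳ)
  open Sums homogeneousMonoid public using ()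
    renaming (sum to ∏; sum-cong-≋ to ∏-cong; ∑-comm to ∏-comm; ∑-distrib-+ to ∏-distrib-∙;
              sum-replicate-zero to ∏-1)

  deg-cong : ∀ {x y} → x ≈ʰ y → proj₁ x ≡ proj₁ y
  deg-cong (same _) = refl

  deg-∏ : ∀ {k} (a : Fin k → H) → proj₁ (∏ a) ≡ ∑ℤ (proj₁ ∘ a)
  deg-∏ {zero}  a = refl
  deg-∏ {suc k} a = cong (ℤ._+_ (proj₁ (a zero))) (deg-∏ (a ∘ suc))

  infix 8 [_]*_
  [_]*_ : ∀ {p} {P : Set p} → Dec P → H → H
  [ yes _ ]* x = x
  [ no  _ ]* x = 1ʰ

  []*-true : ∀ {p} {P : Set p} (P? : Dec P) → P → ∀ {x} → [ P? ]* x ≈ʰ x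
  []*-true (yes _) p = ≈ʰ-refl
  []*-true (no ¬p) p = contradiction p ¬p

  []*-false : ∀ {p} {P : Set p} (P? : Dec P) → ¬ P → ∀ {x} → [ P? ]* x ≈ʰ 1ʰ
  []*-false (yes p) ¬p = contradiction p ¬p
  []*-false (no _)  ¬p = ≈ʰ-refl

  []*-cong : ∀ {p} {P : Set p} (P? : Dec P) {x y} → x ≈ʰ y → [ P? ]* x ≈ʰ [ P? ]* y
  []*-cong (yes _) x≈y = x≈y
  []*-cong (no _)  _   = ≈ʰ-refl

  ∏-const-1 : ∀ {k} (a : Fin k → H) → (∀ c → a c ≈ʰ 1ʰ) → ∏ a ≈ʰ 1ʰ
  ∏-const-1 {k} a a≈1 = ≈ʰ-trans (∏-cong a≈1) (∏-1 k)

  ∏-single : ∀ {k} (a : Fin k → H) c₀ → (∀ c → c ≢ c₀ → a c ≈ʰ 1ʰ) → ∏ a ≈ʰ a c₀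
  ∏-single a zero a≈1 =
    ≈ʰ-trans (∙-cong ≈ʰ-refl (∏-const-1 (a ∘ suc) (λ c → a≈1 (suc c) λ ()))) (∙-identityʳ _)
  ∏-single a (suc c₀) a≈1 =
    ≈ʰ-trans (∙-cong (a≈1 zero λ ()) (∏-single (a ∘ suc) c₀
      (λ c c≢c₀ → a≈1 (suc c) (c≢c₀ ∘ Finₚ.suc-injective)))) (∙-identityˡ _)

  -- The product of the factors of a lying over c′, for each c′.
  fibreProduct : ∀ {k l} → (Fin k → Fin l) → (Fin k → H) → Fin l → H
  fibreProduct f a c′ = ∏ λ c → [ f c ≟ c′ ]* a c

  ∏-fibreProduct : ∀ {k l} (f : Fin k → Fin l) (a : Fin k → H) → ∏ (fibreProduct f a) ≈ʰ ∏ a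
  ∏-fibreProduct f a = ≈ʰ-trans (∏-comm (λ c′ c → [ f c ≟ c′ ]* a c))
    (∏-cong λ c → ≈ʰ-trans
      (∏-single (λ c′ → [ f c ≟ c′ ]* a c) (f c)
        (λ c′ c′≢ → []*-false (f c ≟ c′) (c′≢ ∘ ≡.sym)))
      ([]*-true (f c ≟ f c) refl))

  fibreProduct-single : ∀ {k l} (f : Fin k → Fin l) (a : Fin k → H) {c′} c₁ → f c₁ ≡ c′ →
    (∀ c → f c ≡ c′ → c ≡ c₁) → fibreProduct f a c′ ≈ʰ a c₁
  fibreProduct-single f a {c′} c₁ fc₁ only = ≈ʰ-trans
    (∏-single _ c₁ (λ c c≢c₁ → []*-false (f c ≟ c′) (c≢c₁ ∘ only c)))
    ([]*-true (f c₁ ≟ c′) fc₁)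

  fibreProduct-pair : ∀ {k l} (f : Fin k → Fin l) (a : Fin k → H) {c′} c₁ c₂ → c₁ ≢ c₂ →
    f c₁ ≡ c′ → f c₂ ≡ c′ → (∀ c → f c ≡ c′ → c ≡ c₁ ⊎ c ≡ c₂) →
    fibreProduct f a c′ ≈ʰ a c₁ ∙ a c₂
  fibreProduct-pair f a {c′} c₁ c₂ c₁≢c₂ fc₁ fc₂ only = ≈ʰ-trans (∏-cong split)
    (≈ʰ-trans (∏-distrib-∙ (λ c → [ c ≟ c₁ ]* a c) (λ c → [ c ≟ c₂ ]* a c))
      (∙-cong (pick c₁) (pick c₂)))
    where
    pick : ∀ c₀ → ∏ (λ c → [ c ≟ c₀ ]* a c) ≈ʰ a c₀
    pick c₀ = ≈ʰ-trans (∏-single _ c₀ (λ c c≢c₀ → []*-false (c ≟ c₀) c≢c₀)) ([]*-true (c₀ ≟ c₀) refl)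

    split : ∀ c → [ f c ≟ c′ ]* a c ≈ʰ [ c ≟ c₁ ]* a c ∙ [ c ≟ c₂ ]* a c
    split c with c ≟ c₁ | c ≟ c₂
    ... | yes p    | yes q    = contradiction (≡.trans (≡.sym p) q) c₁≢c₂
    ... | yes refl | no _     = ≈ʰ-trans ([]*-true (f c ≟ c′) fc₁) (≈ʰ-sym (∙-identityʳ _))
    ... | no _     | yes refl = ≈ʰ-trans ([]*-true (f c ≟ c′) fc₂) (≈ʰ-sym (∙-identityˡ _))
    ... | no p     | no q     = ≈ʰ-trans
      ([]*-false (f c ≟ c′) ([ p , q ]′ ∘ only c)) (≈ʰ-sym (∙-identityˡ _))

  fibreProduct-cong : ∀ {k l} (f : Fin k → Fin l) {a b : Fin k → H} → (∀ c → a c ≈ʰ b c) →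
                      ∀ c′ → fibreProduct f a c′ ≈ʰ fibreProduct f b c′
  fibreProduct-cong f a≈b c′ = ∏-cong λ c → []*-cong (f c ≟ c′) (a≈b c)

  fibreProduct-∘ : ∀ {k l j} (f : Fin k → Fin l) (g : Fin l → Fin j) (a : Fin k → H) c″ →
                   fibreProduct g (fibreProduct f a) c″ ≈ʰ fibreProduct (g ∘ f) a c″
  fibreProduct-∘ f g a c″ = ≈ʰ-trans
    (∏-cong λ c′ → []*-∏ (g c′ ≟ c″) (λ c → [ f c ≟ c′ ]* a c))
    (≈ʰ-trans (∏-comm (λ c′ c → [ g c′ ≟ c″ ]* ([ f c ≟ c′ ]* a c)))
      (∏-cong λ c → ≈ʰ-trans
        (∏-single (λ c′ → [ g c′ ≟ c″ ]* ([ f c ≟ c′ ]* a c)) (f c)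
          (λ c′ c′≢fc → ≈ʰ-trans
            ([]*-cong (g c′ ≟ c″) ([]*-false (f c ≟ c′) (c′≢fc ∘ ≡.sym)))
            ([]*-1 (g c′ ≟ c″))))
        ([]*-cong (g (f c) ≟ c″) ([]*-true (f c ≟ f c) refl))))
    where
    []*-1 : ∀ {p} {P : Set p} (P? : Dec P) → [ P? ]* 1ʰ ≈ʰ 1ʰ
    []*-1 (yes _) = ≈ʰ-refl
    []*-1 (no _)  = ≈ʰ-refl

    []*-∏ : ∀ {p} {P : Set p} (P? : Dec P) {k} (a : Fin k → H) →
            [ P? ]* ∏ a ≈ʰ ∏ λ c → [ P? ]* a c
    []*-∏ (yes _) a = ≈ʰ-refl
    []*-∏ (no _) {k} a = ≈ʰ-sym (∏-const-1 {k} (λ _ → 1ʰ) (λ _ → ≈ʰ-refl))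

  IsSum-resp : ∀ {x x′ y y′ z z′} → x ≈ʰ x′ → y ≈ʰ y′ → z ≈ʰ z′ →
               IsSum component x y z → IsSum component x′ y′ z′
  IsSum-resp (same p) (same q) (same t) (isSum e) =
    isSum (C.≈ᴹ-trans (C.≈ᴹ-sym t) (C.≈ᴹ-trans e (C.+ᴹ-cong p q)))

  IsSum-∙ˡ : ∀ {x y z} w → IsSum component x y z → IsSum component (x ∙ w) (y ∙ w) (z ∙ w)
  IsSum-∙ˡ (_ , w) (isSum e) = isSum (C.≈ᴹ-trans (·-cong e C.≈ᴹ-refl) (·-distribʳ w _ _))

  IsMultiple-resp : ∀ {s x x′ z z′} → x ≈ʰ x′ → z ≈ʰ z′ →
                    IsMultiple component s x z → IsMultiple component s x′ z′
  IsMultiple-resp (same p) (same t) (isMultiple e) =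
    isMultiple (C.≈ᴹ-trans (C.≈ᴹ-sym t) (C.≈ᴹ-trans e (C.*ₗ-congˡ p)))

  IsMultiple-∙ˡ : ∀ {s x z} w → IsMultiple component s x z →
                  IsMultiple component s (x ∙ w) (z ∙ w)
  IsMultiple-∙ˡ (_ , w) (isMultiple e) =
    isMultiple (C.≈ᴹ-trans (·-cong e C.≈ᴹ-refl) (·-scaleˡ _ _ w))

  ∏-IsSum : ∀ {k} {a b s : Fin k → H} c → IsSum component (a c) (b c) (s c) →
            (∀ c′ → c′ ≢ c → s c′ ≈ʰ a c′ × s c′ ≈ʰ b c′) →
            IsSum component (∏ a) (∏ b) (∏ s)
  ∏-IsSum {s = s} zero e off = IsSum-resp
    (∙-cong ≈ʰ-refl (∏-cong λ c → proj₁ (off (suc c) λ ())))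
    (∙-cong ≈ʰ-refl (∏-cong λ c → proj₂ (off (suc c) λ ())))
    ≈ʰ-refl (IsSum-∙ˡ (∏ (s ∘ suc)) e)
  ∏-IsSum {a = a} {b} {s} (suc c) e off = IsSum-resp
    (≈ʰ-trans (∙-comm _ _) (∙-cong (proj₁ (off zero λ ())) ≈ʰ-refl))
    (≈ʰ-trans (∙-comm _ _) (∙-cong (proj₂ (off zero λ ())) ≈ʰ-refl))
    (∙-comm _ _)
    (IsSum-∙ˡ (s zero) (∏-IsSum c e (λ c′ c′≢c → off (suc c′) (c′≢c ∘ Finₚ.suc-injective))))

  ∏-IsMultiple : ∀ {k t} {a s : Fin k → H} c → IsMultiple component t (a c) (s c) →
                 (∀ c′ → c′ ≢ c → s c′ ≈ʰ a c′) → IsMultiple component t (∏ a) (∏ s)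
  ∏-IsMultiple {s = s} zero e off = IsMultiple-resp
    (∙-cong ≈ʰ-refl (∏-cong λ c → off (suc c) λ ()))
    ≈ʰ-refl (IsMultiple-∙ˡ (∏ (s ∘ suc)) e)
  ∏-IsMultiple {s = s} (suc c) e off = IsMultiple-resp
    (≈ʰ-trans (∙-comm _ _) (∙-cong (off zero λ ()) ≈ʰ-refl))
    (∙-comm _ _)
    (IsMultiple-∙ˡ (s zero) (∏-IsMultiple c e (λ c′ c′≢c → off (suc c′) (c′≢c ∘ Finₚ.suc-injective))))

  -- An operation on families of homogeneous elements which multiplies the
  -- factors along the fibres of f induces a map of tensor powers.
  module AlongFibres {k l} (f : Fin k → Fin l) (φ : (Fin k → H) → (Fin l → H))
                     (φ≈ : ∀ a c′ → φ a c′ ≈ʰ fibreProduct f a c′) where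

    φ-deg : ∀ a → ∑ℤ (proj₁ ∘ φ a) ≡ ∑ℤ (proj₁ ∘ a)
    φ-deg a = ≡.trans (≡.sym (deg-∏ (φ a)))
      (≡.trans (deg-cong (≈ʰ-trans (∏-cong (φ≈ a)) (∏-fibreProduct f a))) (deg-∏ a))

    φ-agree : ∀ {a b} c′ → (∀ c → f c ≡ c′ → a c ≈ʰ b c) → φ a c′ ≈ʰ φ b c′
    φ-agree {a} {b} c′ a≈b = ≈ʰ-trans (φ≈ a c′) (≈ʰ-trans (∏-cong go) (≈ʰ-sym (φ≈ b c′)))
      where
      go : ∀ c → [ f c ≟ c′ ]* a c ≈ʰ [ f c ≟ c′ ]* b c
      go c with f c ≟ c′
      ... | yes p = a≈b c p
      ... | no _  = ≈ʰ-refl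

    private
      T : ∀ d k → Set (r ⊔ m)
      T d k = Tensor component k d

    fun : ∀ {d} → T d k → T d l
    fun (⨂ a p)  = ⨂ (φ a) (≡.trans (φ-deg a) p)
    fun 0ᵗ       = 0ᵗ
    fun (x +ᵗ y) = fun x +ᵗ fun y
    fun (-ᵗ x)   = -ᵗ fun x
    fun (s *ᵗ x) = s *ᵗ fun x

    private
      []*-IsSum : ∀ {x y z c} → IsSum component x y z →
                  IsSum component ([ f c ≟ f c ]* x) ([ f c ≟ f c ]* y) ([ f c ≟ f c ]* z)
      []*-IsSum {c = c} = IsSum-resp (≈ʰ-sym t) (≈ʰ-sym t) (≈ʰ-sym t)
        where
        t : ∀ {x} → [ f c ≟ f c ]* x ≈ʰ x
        t = []*-true (f c ≟ f c) refl

      []*-IsMultiple : ∀ {s x z c} → IsMultiple component s x z →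
                       IsMultiple component s ([ f c ≟ f c ]* x) ([ f c ≟ f c ]* z)
      []*-IsMultiple {c = c} = IsMultiple-resp (≈ʰ-sym t) (≈ʰ-sym t)
        where
        t : ∀ {x} → [ f c ≟ f c ]* x ≈ʰ x
        t = []*-true (f c ≟ f c) refl

      off-fibre : ∀ {c c′} → c′ ≢ f c → ∀ c₁ → f c₁ ≡ c′ → c₁ ≢ c
      off-fibre c′≢fc c₁ p refl = c′≢fc (≡.sym p)

    fun-cong : ∀ {d} {x y : T d k} → _≈ᵗ_ component x y → _≈ᵗ_ component (fun x) (fun y)
    fun-cong ≈refl            = ≈refl
    fun-cong (≈sym e)         = ≈sym (fun-cong e)
    fun-cong (≈trans e e′)    = ≈trans (fun-cong e) (fun-cong e′)
    fun-cong (+-cong e e′)    = +-cong (fun-cong e) (fun-cong e′)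
    fun-cong (+-assoc x y z)  = +-assoc _ _ _
    fun-cong (+-comm x y)     = +-comm _ _
    fun-cong (+-identityˡ x)  = +-identityˡ _
    fun-cong (neg-cong e)     = neg-cong (fun-cong e)
    fun-cong (neg-inverseˡ x) = neg-inverseˡ _
    fun-cong (*-cong p e)     = *-cong p (fun-cong e)
    fun-cong (*-assoc s t x)  = *-assoc s t _
    fun-cong (*-identityˡ x)  = *-identityˡ _
    fun-cong (*-distribˡ s x y) = *-distribˡ s _ _
    fun-cong (*-distribʳ x s t) = *-distribʳ _ s t
    fun-cong (*-zeroˡ x)      = *-zeroˡ _
    fun-cong (*-zeroʳ s)      = *-zeroʳ s
    fun-cong (⨂-cong e)       = ⨂-cong λ c′ → φ-agree c′ λ c _ → e c
    fun-cong (⨂-add {a} {b} {s} c e off) = ⨂-add (f c)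
      (IsSum-resp (≈ʰ-sym (φ≈ a (f c))) (≈ʰ-sym (φ≈ b (f c))) (≈ʰ-sym (φ≈ s (f c)))
        (∏-IsSum c ([]*-IsSum {c = c} e) λ c′ c′≢c →
          []*-cong (f c′ ≟ f c) (proj₁ (off c′ c′≢c)) ,
          []*-cong (f c′ ≟ f c) (proj₂ (off c′ c′≢c))))
      (λ c′ c′≢fc →
        φ-agree c′ (λ c₁ p → proj₁ (off c₁ (off-fibre c′≢fc c₁ p))) ,
        φ-agree c′ (λ c₁ p → proj₂ (off c₁ (off-fibre c′≢fc c₁ p))))
    fun-cong (⨂-scale {a} {z} c s e off) = ⨂-scale (f c) s
      (IsMultiple-resp (≈ʰ-sym (φ≈ a (f c))) (≈ʰ-sym (φ≈ z (f c)))
        (∏-IsMultiple c ([]*-IsMultiple {c = c} e) λ c′ c′≢c →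
          []*-cong (f c′ ≟ f c) (off c′ c′≢c)))
      (λ c′ c′≢fc → φ-agree c′ (λ c₁ p → off c₁ (off-fibre c′≢fc c₁ p)))

    map : GradedMap (TensorPower component k) (TensorPower component l)
    map d = linearMap (TensorPower component k d) (TensorPower component l d)
      fun fun-cong (λ _ _ → ≈refl) (λ _ _ → ≈refl)

  module _ {k l l′ j} (f : Fin k → Fin l) (g : Fin l → Fin j)
           (f′ : Fin k → Fin l′) (g′ : Fin l′ → Fin j)
           (φ : (Fin k → H) → Fin l → H) (γ : (Fin l → H) → Fin j → H)
           (φ′ : (Fin k → H) → Fin l′ → H) (γ′ : (Fin l′ → H) → Fin j → H)
           (φ≈ : ∀ a c → φ a c ≈ʰ fibreProduct f a c)
           (γ≈ : ∀ a c → γ a c ≈ʰ fibreProduct g a c)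
           (φ′≈ : ∀ a c → φ′ a c ≈ʰ fibreProduct f′ a c)
           (γ′≈ : ∀ a c → γ′ a c ≈ʰ fibreProduct g′ a c)
           (gf≗ : ∀ c → g (f c) ≡ g′ (f′ c)) where
    private
      module F  = AlongFibres f φ φ≈
      module G  = AlongFibres g γ γ≈
      module F′ = AlongFibres f′ φ′ φ′≈
      module G′ = AlongFibres g′ γ′ γ′≈

      composite : ∀ {l} (f : Fin k → Fin l) (g : Fin l → Fin j)
                  (φ : (Fin k → H) → Fin l → H) (γ : (Fin l → H) → Fin j → H) →
                  (∀ a c → φ a c ≈ʰ fibreProduct f a c) → (∀ a c → γ a c ≈ʰ fibreProduct g a c) →
                  ∀ a c → γ (φ a) c ≈ʰ fibreProduct (g ∘ f) a c
      composite f g φ γ φ≈ γ≈ a c = ≈ʰ-trans (γ≈ _ c)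
        (≈ʰ-trans (fibreProduct-cong g (φ≈ a) c) (fibreProduct-∘ f g a c))

      reindex : ∀ a c → fibreProduct (g ∘ f) a c ≈ʰ fibreProduct (g′ ∘ f′) a c
      reindex a c = ∏-cong λ c₁ → step (g (f c₁) ≟ c) (g′ (f′ c₁) ≟ c) (gf≗ c₁)
        where
        step : ∀ {c₁ c₂ x} (d : Dec (c₁ ≡ c)) (d′ : Dec (c₂ ≡ c)) → c₁ ≡ c₂ → [ d ]* x ≈ʰ [ d′ ]* x
        step (yes p) d′ refl = ≈ʰ-sym ([]*-true d′ p)
        step (no ¬p) d′ refl = ≈ʰ-sym ([]*-false d′ ¬p)

    squareCommutes : ∀ {d} (x : Tensor component k d) →
                     _≈ᵗ_ component (G.fun (F.fun x)) (G′.fun (F′.fun x))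
    squareCommutes (⨂ a p)  = ⨂-cong λ c → ≈ʰ-trans (composite f g φ γ φ≈ γ≈ a c)
      (≈ʰ-trans (reindex a c) (≈ʰ-sym (composite f′ g′ φ′ γ′ φ′≈ γ′≈ a c)))
    squareCommutes 0ᵗ       = ≈refl
    squareCommutes (x +ᵗ y) = +-cong (squareCommutes x) (squareCommutes y)
    squareCommutes (-ᵗ x)   = neg-cong (squareCommutes x)
    squareCommutes (s *ᵗ x) = *-cong (CommutativeRing.refl R) (squareCommutes x)

-- A graph on the vertex set Fin vertices with an ordering e₀, e₁, … of its edges: the
-- two-element set eᵢ is given by its endpoints in increasing order, and the
-- enumeration of the edges, being injective, is the ordering.
record OrderedGraph : Set where
  field
    vertices edges : ℕ
    ends           : Fin edges → Fin vertices × Fin vertices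
    ends-increase  : ∀ e → proj₁ (ends e) Fin.< proj₂ (ends e)
    ends-injective : Injective _≡_ _≡_ ends

-- The classes of an equivalence relation on Fin n, numbered from 0.
record Quotient {n} (_~_ : Rel (Fin n) 0ℓ) : Set where
  field
    size      : ℕ
    class     : Fin n → Fin size
    rep       : Fin size → Fin n
    class-rep : ∀ c → class (rep c) ≡ c
    sound     : ∀ {x y} → x ~ y → class x ≡ class y
    complete  : ∀ {x y} → class x ≡ class y → x ~ y

infix 4 _⋖[_]_

_⋖[_]_ : ∀ {m} → Subset m → Fin m → Subset m → Set
S ⋖[ e ] T = e ∉ S × T ≡ S ∪ ⁅ e ⁆

module Spanning {n m} (ends : Fin m → Fin n × Fin n) where

  Joins : Fin m → Fin n → Fin n → Set
  Joins e x y = ends e ≡ (x , y) ⊎ ends e ≡ (y , x)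

  Adjacent : Subset m → Rel (Fin n) 0ℓ
  Adjacent S x y = ∃ λ e → e ∈ S × Joins e x y

  Connected : Subset m → Rel (Fin n) 0ℓ
  Connected S = Star (Adjacent S)

  connected-sym : ∀ {S x y} → Connected S x y → Connected S y x
  connected-sym {S} = Star.reverse λ (e , e∈S , j) → e , e∈S , swap j

  connected-mono : ∀ {S T x y} → S ⊆ T → Connected S x y → Connected T x y
  connected-mono S⊆T = Star.map λ (e , e∈S , j) → e , S⊆T e∈S , j

  module _ {S T : Subset m} {e : Fin m} (T≡ : T ≡ S ∪ ⁅ e ⁆) where
    private
      u = proj₁ (ends e)
      v = proj₂ (ends e)

    ∪-⊆ : S ⊆ T
    ∪-⊆ x∈S = subst (_ ∈_) (≡.sym T≡) (x∈p∪q⁺ (inj₁ x∈S))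

    ends-connected : Connected T u v
    ends-connected =
      (e , subst (e ∈_) (≡.sym T≡) (x∈p∪q⁺ (inj₂ (x∈⁅x⁆ e))) , inj₁ refl) ◅ ε

    Near : Fin n → Set
    Near x = Connected S x u ⊎ Connected S x v

    near-connected : ∀ {x} → Near x → Connected T x u
    near-connected (inj₁ p) = connected-mono ∪-⊆ p
    near-connected (inj₂ p) = connected-mono ∪-⊆ p ◅◅ connected-sym ends-connected

    private
      near-resp : ∀ {x y} → Connected S x y → Near y → Near x
      near-resp p (inj₁ q) = inj₁ (p ◅◅ q)
      near-resp p (inj₂ q) = inj₂ (p ◅◅ q)

      joins-near : ∀ {x y} → Joins e x y → Near x × Near y
      joins-near (inj₁ refl) = inj₁ ε , inj₂ ε
      joins-near (inj₂ refl) = inj₂ ε , inj₁ ε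

    connected-∪⁻ : ∀ {x y} → Connected T x y → Connected S x y ⊎ (Near x × Near y)
    connected-∪⁻ ε = inj₁ ε
    connected-∪⁻ ((e′ , e′∈T , j) ◅ p)
      with x∈p∪q⁻ S ⁅ e ⁆ (subst (e′ ∈_) T≡ e′∈T) | connected-∪⁻ p
    ... | inj₁ e′∈S | inj₁ q        = inj₁ ((e′ , e′∈S , j) ◅ q)
    ... | inj₁ e′∈S | inj₂ (a , b)  = inj₂ (near-resp ((e′ , e′∈S , j) ◅ ε) a , b)
    ... | inj₂ e′∈e | q with x∈⁅y⁆⇒x≡y e e′∈e
    ...   | refl with joins-near j | q
    ...     | a , b | inj₁ q′      = inj₂ (a , near-resp (connected-sym q′) b)
    ...     | a , b | inj₂ (_ , c) = inj₂ (a , c)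

    connected-∪⁺ : ∀ {x y} → Connected S x y ⊎ (Near x × Near y) → Connected T x y
    connected-∪⁺ (inj₁ p)       = connected-mono ∪-⊆ p
    connected-∪⁺ (inj₂ (a , b)) = near-connected a ◅◅ connected-sym (near-connected b)

quotient-resp : ∀ {n} {_~_ _~′_ : Rel (Fin n) 0ℓ} →
                (∀ {x y} → x ~ y → x ~′ y) → (∀ {x y} → x ~′ y → x ~ y) →
                Quotient _~_ → Quotient _~′_
quotient-resp to from q = record
  { size = size ; class = class ; rep = rep ; class-rep = class-rep
  ; sound = sound ∘ from ; complete = to ∘ complete }
  where open Quotient q

module _ {n} {_~_ : Rel (Fin n) 0ℓ} (q : Quotient _~_) (u v : Fin n) where
  private
    Merged : Rel (Fin n) 0ℓ
    Merged x y = x ~ y ⊎ ((x ~ u ⊎ x ~ v) × (y ~ u ⊎ y ~ v))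

    unmerged : Quotient.class q u ≡ Quotient.class q v → Quotient Merged
    unmerged u≡v = record
      { size = size ; class = class ; rep = rep ; class-rep = class-rep
      ; sound = λ { (inj₁ p) → sound p
                  ; (inj₂ (a , b)) → ≡.trans (near a) (≡.sym (near b)) }
      ; complete = inj₁ ∘ complete }
      where
      open Quotient q
      near : ∀ {x} → x ~ u ⊎ x ~ v → class x ≡ class u
      near (inj₁ p) = sound p
      near (inj₂ p) = ≡.trans (sound p) (≡.sym u≡v)

    module Collapse {k} (a b : Fin (suc k)) (b≢a : b ≢ a) where
      collapse′ : (c : Fin (suc k)) → Dec (b ≡ c) → Fin k
      collapse′ c (yes _)  = punchOut b≢a
      collapse′ c (no b≢c) = punchOut b≢c

      collapse : Fin (suc k) → Fin k
      collapse c = collapse′ c (b ≟ c)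

      collapse-b : collapse b ≡ punchOut b≢a
      collapse-b with b ≟ b
      ... | yes _  = refl
      ... | no b≢b = contradiction refl b≢b

      collapse-≢ : ∀ c (b≢c : b ≢ c) → collapse c ≡ punchOut b≢c
      collapse-≢ c b≢c with b ≟ c
      ... | yes b≡c = contradiction b≡c b≢c
      ... | no _    = punchOut-cong b refl

      collapse-a≡b : collapse a ≡ collapse b
      collapse-a≡b = ≡.trans (collapse-≢ a b≢a) (≡.sym collapse-b)

      collapse-injective : ∀ c d → collapse c ≡ collapse d →
                           c ≡ d ⊎ ((c ≡ a ⊎ c ≡ b) × (d ≡ a ⊎ d ≡ b))
      collapse-injective c d eq with b ≟ c | b ≟ d
      ... | yes p  | yes p′ = inj₂ (inj₂ (≡.sym p) , inj₂ (≡.sym p′))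
      ... | yes p  | no p′  = inj₂ (inj₂ (≡.sym p) , inj₁ (≡.sym (punchOut-injective b≢a p′ eq)))
      ... | no p   | yes p′ = inj₂ (inj₁ (punchOut-injective p b≢a eq) , inj₂ (≡.sym p′))
      ... | no p   | no p′  = inj₁ (punchOut-injective p p′ eq)

      collapse-punchIn : ∀ c → collapse (punchIn b c) ≡ c
      collapse-punchIn c =
        ≡.trans (collapse-≢ _ (punchInᵢ≢i b c ∘ ≡.sym)) (punchOut-punchIn b)

    collapsed : ∀ k (class : Fin n → Fin k) (rep : Fin k → Fin n) →
                (∀ c → class (rep c) ≡ c) →
                (∀ {x y} → x ~ y → class x ≡ class y) →
                (∀ {x y} → class x ≡ class y → x ~ y) →
                class u ≢ class v → Quotient Merged
    collapsed zero class _ _ _ _ _ with class u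
    ... | ()
    collapsed (suc k) class rep class-rep sound complete u≢v = record
      { size = k
      ; class = collapse ∘ class
      ; rep = rep ∘ punchIn (class v)
      ; class-rep = λ c → ≡.trans (cong collapse (class-rep _)) (collapse-punchIn c)
      ; sound = λ { (inj₁ p) → cong collapse (sound p)
                  ; (inj₂ (a , b)) → ≡.trans (near a) (≡.sym (near b)) }
      ; complete = λ {x} {y} eq → merged (collapse-injective (class x) (class y) eq)
      }
      where
      open Collapse (class u) (class v) (u≢v ∘ ≡.sym)
      near : ∀ {x} → x ~ u ⊎ x ~ v → collapse (class x) ≡ collapse (class v)
      near (inj₁ p) = ≡.trans (cong collapse (sound p)) collapse-a≡b
      near (inj₂ p) = cong collapse (sound p)
      near⁻ : ∀ {x} → class x ≡ class u ⊎ class x ≡ class v → x ~ u ⊎ x ~ v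
      near⁻ (inj₁ p) = inj₁ (complete p)
      near⁻ (inj₂ p) = inj₂ (complete p)
      merged : ∀ {x y} → class x ≡ class y ⊎ ((class x ≡ class u ⊎ class x ≡ class v) ×
               (class y ≡ class u ⊎ class y ≡ class v)) → Merged x y
      merged (inj₁ p)       = inj₁ (complete p)
      merged (inj₂ (a , b)) = inj₂ (near⁻ a , near⁻ b)

  quotient-merge : Quotient Merged
  quotient-merge with Quotient.class q u ≟ Quotient.class q v
  ... | yes u≡v = unmerged u≡v
  ... | no u≢v  = collapsed size class rep class-rep sound complete u≢v
    where open Quotient q

private
  adjacent-drop : ∀ {n m} (ends : Fin (suc m) → Fin n × Fin n) {S} {x y} →
    Spanning.Adjacent ends (outside ∷ S) x y → Spanning.Adjacent (ends ∘ suc) S x y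
  adjacent-drop ends (suc e , there e∈S , j) = e , e∈S , j

  adjacent-lift : ∀ {n m} (ends : Fin (suc m) → Fin n × Fin n) {S} {x y} →
    Spanning.Adjacent (ends ∘ suc) S x y → Spanning.Adjacent ends (outside ∷ S) x y
  adjacent-lift ends (e , e∈S , j) = suc e , there e∈S , j

-- k(S) is the size of this quotient.
components : ∀ {n m} (ends : Fin m → Fin n × Fin n) (S : Subset m) →
             Quotient (Spanning.Connected ends S)
components {m = zero} ends [] = record
  { size = _ ; class = id ; rep = id ; class-rep = λ _ → refl
  ; sound = λ { ε → refl ; ((() , _) ◅ _) }
  ; complete = λ { refl → ε }
  }
components {m = suc m} ends (s ∷ S) = with-first-edge s
  where
  open Spanning ends
  without : Quotient (Connected (outside ∷ S))
  without = quotient-resp (Star.map (adjacent-lift ends)) (Star.map (adjacent-drop ends))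
    (components (ends ∘ suc) S)
  T≡ : inside ∷ S ≡ (outside ∷ S) ∪ ⁅ zero ⁆
  T≡ = cong (inside ∷_) (≡.sym (∪-identityʳ S))
  with-first-edge : ∀ s → Quotient (Connected (s ∷ S))
  with-first-edge outside = without
  with-first-edge inside  = quotient-resp (connected-∪⁺ T≡) (connected-∪⁻ T≡)
    (quotient-merge without (proj₁ (ends zero)) (proj₂ (ends zero)))

-- A functor from the poset of subsets of Fin m to graded modules, given by its
-- maps on cover relations; these determine the functor, and they extend to all
-- inclusions exactly when the squares commute.
record CubeFunctor (R : CommutativeRing r ℓr) (m : ℕ) c ℓc : Set (r ⊔ ℓr ⊔ lsuc (c ⊔ ℓc)) where
  field
    obj : Subset m → GradedModule R c ℓc
    map : ∀ {S T} e → S ⋖[ e ] T → GradedMap (obj S) (obj T)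

  private
    fun : ∀ {S T} e → S ⋖[ e ] T → ∀ d → Module.Carrierᴹ (obj S d) → Module.Carrierᴹ (obj T d)
    fun e p d = LinearMap.fun (map e p d)

  field
    square : ∀ {S T T′ U e f} (p : S ⋖[ e ] T) (q : T ⋖[ f ] U) (p′ : S ⋖[ f ] T′) (q′ : T′ ⋖[ e ] U) →
             ∀ d x → Module._≈ᴹ_ (obj U d) (fun f q d (fun e p d x)) (fun e q′ d (fun f p′ d x))

module Chromatic {R : CommutativeRing r ℓr} (𝓐 : CommutativeGradedAlgebra R m ℓm)
                 (G : OrderedGraph) where
  open CommutativeGradedAlgebra 𝓐 using (component)
  open Products 𝓐
  open OrderedGraph G
  open Spanning ends
  private
    module K S = Quotient (components ends S)

  obj : Subset edges → GradedModule R _ _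
  obj S = TensorPower component (K.size S)

  module _ {S T : Subset edges} (e : Fin edges) (S⋖T : S ⋖[ e ] T) where
    private
      T≡ = proj₂ S⋖T
      u = proj₁ (ends e)
      v = proj₂ (ends e)

    -- The component of T containing a given component of S.
    into : Fin (K.size S) → Fin (K.size T)
    into c = K.class T (K.rep S c)

    -- For a component of T not created by e, the same component of S.
    back : Fin (K.size T) → Fin (K.size S)
    back c′ = K.class S (K.rep T c′)

    -- The map sends ⨂ a to ⨂ (factors a).  If e joins two distinct components of
    -- S, the component of T containing e receives the product of their two
    -- factors.  Every other factor stays with its component: if e completes a
    -- cycle then S and T have the same components and the map is the identity,
    -- up to the numbering of the components.
    factor : (a : Fin (K.size S) → H) (c′ : Fin (K.size T)) →
             Dec (K.class S u ≡ K.class S v) → Dec (c′ ≡ K.class T u) → H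
    factor a c′ (no _) (yes _) = a (K.class S u) ∙ a (K.class S v)
    factor a c′ _      _       = a (back c′)

    factors : (Fin (K.size S) → H) → Fin (K.size T) → H
    factors a c′ = factor a c′ (K.class S u ≟ K.class S v) (c′ ≟ K.class T u)

    into-class : ∀ x → into (K.class S x) ≡ K.class T x
    into-class x = K.sound T (connected-mono (∪-⊆ T≡) (K.complete S (K.class-rep S _)))

    private
      into-back : ∀ c′ → into (back c′) ≡ c′
      into-back c′ = ≡.trans
        (K.sound T (connected-mono (∪-⊆ T≡) (K.complete S (K.class-rep S (back c′)))))
        (K.class-rep T c′)

      same-component : ∀ {c c′} → Connected S (K.rep S c) (K.rep T c′) → c ≡ back c′
      same-component {c} p = ≡.trans (≡.sym (K.class-rep S c)) (K.sound S p)

      into-connected : ∀ {c c′} → into c ≡ c′ → Connected T (K.rep S c) (K.rep T c′)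
      into-connected {c} {c′} p = K.complete T (≡.trans p (≡.sym (K.class-rep T c′)))

      near-class : ∀ {c} → Near T≡ (K.rep S c) → c ≡ K.class S u ⊎ c ≡ K.class S v
      near-class {c} (inj₁ p) = inj₁ (≡.trans (≡.sym (K.class-rep S c)) (K.sound S p))
      near-class {c} (inj₂ p) = inj₂ (≡.trans (≡.sym (K.class-rep S c)) (K.sound S p))

      near-component : ∀ {c′} → Near T≡ (K.rep T c′) → c′ ≡ K.class T u
      near-component {c′} p =
        ≡.trans (≡.sym (K.class-rep T c′)) (K.sound T (near-connected T≡ p))

      unchanged : ∀ a c′ → (∀ c → into c ≡ c′ → c ≡ back c′) →
                  a (back c′) ≈ʰ fibreProduct into a c′
      unchanged a c′ only =
        ≈ʰ-sym (fibreProduct-single into a (back c′) (into-back c′) only)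

      factor≈ : ∀ a c′ d d′ → factor a c′ d d′ ≈ʰ fibreProduct into a c′
      factor≈ a c′ (yes u~v) _ = unchanged a c′ only
        where
        to-u : ∀ {x} → Near T≡ x → Connected S x u
        to-u (inj₁ p) = p
        to-u (inj₂ p) = p ◅◅ connected-sym (K.complete S u~v)

        only : ∀ c → into c ≡ c′ → c ≡ back c′
        only c p with connected-∪⁻ T≡ (into-connected p)
        ... | inj₁ q       = same-component q
        ... | inj₂ (x , y) = same-component (to-u x ◅◅ connected-sym (to-u y))
      factor≈ a c′ (no u≁v) (yes c′≡u) = ≈ʰ-sym
        (fibreProduct-pair into a (K.class S u) (K.class S v) u≁v
          (≡.trans (into-class u) (≡.sym c′≡u))
          (≡.trans (into-class v)
            (≡.trans (≡.sym (K.sound T (ends-connected T≡))) (≡.sym c′≡u)))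
          only)
        where
        only : ∀ c → into c ≡ c′ → c ≡ K.class S u ⊎ c ≡ K.class S v
        only c p with connected-∪⁻ T≡ {K.rep S c} {u} (K.complete T (≡.trans p c′≡u))
        ... | inj₁ q       = near-class (inj₁ q)
        ... | inj₂ (x , _) = near-class x
      factor≈ a c′ (no u≁v) (no c′≢u) = unchanged a c′ only
        where
        only : ∀ c → into c ≡ c′ → c ≡ back c′
        only c p with connected-∪⁻ T≡ (into-connected p)
        ... | inj₁ q       = same-component q
        ... | inj₂ (_ , y) = contradiction (near-component y) c′≢u

    factors≈fibreProduct : ∀ a c′ → factors a c′ ≈ʰ fibreProduct into a c′
    factors≈fibreProduct a c′ =
      factor≈ a c′ (K.class S u ≟ K.class S v) (c′ ≟ K.class T u)

    map : GradedMap (obj S) (obj T)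
    map = AlongFibres.map into factors factors≈fibreProduct

  functor : CubeFunctor R edges _ _
  functor = record
    { obj = obj
    ; map = map
    ; square = λ {S} {T} {T′} {U} {e} {f} p q p′ q′ d → squareCommutes
        (into e p) (into f q) (into f p′) (into e q′)
        (factors e p) (factors f q) (factors f p′) (factors e q′)
        (factors≈fibreProduct e p) (factors≈fibreProduct f q)
        (factors≈fibreProduct f p′) (factors≈fibreProduct e q′)
        (λ c → ≡.trans (into-into e p f q c) (≡.sym (into-into f p′ e q′ c)))
    }
    where
    into-into : ∀ {S T U} e (p : S ⋖[ e ] T) f (q : T ⋖[ f ] U) c →
                into f q (into e p c) ≡ K.class U (K.rep S c)
    into-into {S} {T} {U} e p f q c = into-class f q (K.rep S c)

open Chromatic public using () renaming (functor to chromaticFunctor)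

record LowerOrderIdeal (m : ℕ) : Set₁ where
  field
    Member      : Subset m → Set
    down-closed : ∀ {S T} → S ⊆ T → Member T → Member S

wholeCube : ∀ {m} → LowerOrderIdeal m
wholeCube = record { Member = λ _ → Unit ; down-closed = λ _ _ → tt }

removal-⋖ : ∀ {m} {T : Subset m} {e} → e ∈ T → T - e ⋖[ e ] T
removal-⋖ {T = T} {e} e∈T = e∉ T e , ⊆-antisym ⊆₁ ⊆₂
  where
  e∉ : ∀ {m} (T : Subset m) e → e ∉ T - e
  e∉ (inside  ∷ T) zero    ()
  e∉ (outside ∷ T) zero    ()
  e∉ (s ∷ T)       (suc e) (there p) = e∉ T e p
  ⊆₁ : T ⊆ (T - e) ∪ ⁅ e ⁆
  ⊆₁ {x} x∈T with x ≟ e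
  ... | yes refl = x∈p∪q⁺ (inj₂ (x∈⁅x⁆ e))
  ... | no x≢e   = x∈p∪q⁺ (inj₁ (x∈p∧x≢y⇒x∈p-y x∈T x≢e))
  ⊆₂ : (T - e) ∪ ⁅ e ⁆ ⊆ T
  ⊆₂ p with x∈p∪q⁻ (T - e) ⁅ e ⁆ p
  ... | inj₁ q = p─q⊆p T ⁅ e ⁆ q
  ... | inj₂ q = subst (_∈ T) (≡.sym (x∈⁅y⁆⇒x≡y e q)) e∈T

∣removal∣ : ∀ {m} {T : Subset m} {e} → e ∈ T → suc ∣ T - e ∣ ≡ ∣ T ∣
∣removal∣ {T = inside ∷ T}  here      = cong (suc ∘ ∣_∣) (p─⊥≡p T)
∣removal∣ {T = inside ∷ T}  (there p) = cong suc (∣removal∣ p)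
∣removal∣ {T = outside ∷ T} (there p) = ∣removal∣ p

before : ∀ {m} → Fin m → Subset m
before i = tabulate λ j → does (j <? i)

module Cochains {R : CommutativeRing r ℓr} {m : ℕ} (F : CubeFunctor R m c ℓc)
                (Q : LowerOrderIdeal m) where
  open CommutativeRing R using (Carrier; 1#; -_; semiring)
  open SemiringExp semiring using (_^_)
  open CubeFunctor F
  open LowerOrderIdeal Q renaming (Member to _∈Q)
  private
    module F S {d} = Module (obj S d)

  -- c(S ⋖ S ∪ {eᵢ}) = (-1)^#{eⱼ ∈ S : j < i}
  sign : Subset m → Fin m → Carrier
  sign S i = (- 1#) ^ ∣ S ∩ before i ∣

  -- The sum of F(S) over the S ∈ Q with |S| = k is finite, hence a product.
  Cochain : ℕ → ℤ → Set c
  Cochain k d = (S : Subset m) → .(S ∈Q) → .(∣ S ∣ ≡ k) → F.Carrierᴹ S {d}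

  cochains : ℕ → GradedModule R c ℓc
  cochains k d = fromLeftModule (record
    { Carrierᴹ = Cochain k d
    ; _≈ᴹ_ = λ x y → ∀ S .(p : S ∈Q) .(q : ∣ S ∣ ≡ k) → F._≈ᴹ_ S (x S p q) (y S p q)
    ; _+ᴹ_ = λ x y S p q → F._+ᴹ_ S (x S p q) (y S p q)
    ; _*ₗ_ = λ s x S p q → F._*ₗ_ S s (x S p q)
    ; 0ᴹ = λ S p q → F.0ᴹ S
    ; -ᴹ_ = λ x S p q → F.-ᴹ_ S (x S p q)
    ; isLeftModule = record
      { isLeftSemimodule = record
        { +ᴹ-isCommutativeMonoid = record
          { isMonoid = record
            { isSemigroup = record
              { isMagma = record
                { isEquivalence = record
                  { refl = λ S p q → F.≈ᴹ-refl S
                  ; sym = λ e S p q → F.≈ᴹ-sym S (e S p q)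
                  ; trans = λ e f S p q → F.≈ᴹ-trans S (e S p q) (f S p q)
                  }
                ; ∙-cong = λ e f S p q → F.+ᴹ-cong S (e S p q) (f S p q)
                }
              ; assoc = λ x y z S p q → F.+ᴹ-assoc S _ _ _
              }
            ; identity = (λ x S p q → F.+ᴹ-identityˡ S _) , (λ x S p q → F.+ᴹ-identityʳ S _)
            }
          ; comm = λ x y S p q → F.+ᴹ-comm S _ _
          }
        ; isPreleftSemimodule = record
          { *ₗ-cong = λ s≈t e S p q → F.*ₗ-cong S s≈t (e S p q)
          ; *ₗ-zeroˡ = λ x S p q → F.*ₗ-zeroˡ S _
          ; *ₗ-distribʳ = λ x s t S p q → F.*ₗ-distribʳ S _ s t
          ; *ₗ-identityˡ = λ x S p q → F.*ₗ-identityˡ S _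
          ; *ₗ-assoc = λ s t x S p q → F.*ₗ-assoc S s t _
          ; *ₗ-zeroʳ = λ s S p q → F.*ₗ-zeroʳ S s
          ; *ₗ-distribˡ = λ s x y S p q → F.*ₗ-distribˡ S s _ _
          }
        }
      ; -ᴹ‿cong = λ e S p q → F.-ᴹ‿cong S (e S p q)
      ; -ᴹ‿inverse = (λ x S p q → F.-ᴹ‿inverseˡ S _) , (λ x S p q → F.-ᴹ‿inverseʳ S _)
      }
    })

  -- The contribution to (δ x)(T) of the cover relation T ∖ {e} ⋖ T, if e ∈ T.
  summand : ∀ {k d} → Cochain k d → (T : Subset m) → .(T ∈Q) → .(∣ T ∣ ≡ suc k) →
            (e : Fin m) → Dec (e ∈ T) → F.Carrierᴹ T {d}
  summand x T p q e (no _)    = F.0ᴹ T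
  summand x T p q e (yes e∈T) = F._*ₗ_ T (sign (T - e) e)
    (LinearMap.fun (map e (removal-⋖ e∈T) _)
      (x (T - e) (down-closed (p─q⊆p T ⁅ e ⁆) p)
         (ℕₚ.suc-injective (≡.trans (∣removal∣ e∈T) q))))

  δ-fun : ∀ k d → Cochain k d → Cochain (suc k) d
  δ-fun k d x T p q = sum λ e → summand x T p q e (e ∈? T)
    where open Sums (F.+ᴹ-commutativeMonoid T {d}) using (sum)

  δ : ∀ k → GradedMap (cochains k) (cochains (suc k))
  δ k d = linearMap (cochains k d) (cochains (suc k) d) (δ-fun k d)
    (λ e T p q → sum-cong T (λ i → summand-cong e T p q i (i ∈? T)))
    (λ x y T p q → F.≈ᴹ-trans T
      (sum-cong T (λ i → summand-+ x y T p q i (i ∈? T)))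
      (sum-+ T {m} (λ i → summand x T p q i (i ∈? T)) (λ i → summand y T p q i (i ∈? T))))
    (λ s x T p q → F.≈ᴹ-trans T
      (sum-cong T (λ i → summand-* s x T p q i (i ∈? T)))
      (sum-* T s {m} (λ i → summand x T p q i (i ∈? T))))
    where
    open Module (cochains k d) using (_≈ᴹ_; _+ᴹ_; _*ₗ_)
    module Σ′ T = Sums (F.+ᴹ-commutativeMonoid T {d})

    sum-cong : ∀ T {l} {f g : Fin l → _} → (∀ i → F._≈ᴹ_ T {d} (f i) (g i)) →
               F._≈ᴹ_ T (Σ′.sum T f) (Σ′.sum T g)
    sum-cong T = Σ′.sum-cong-≋ T

    sum-+ : ∀ T {l} (f g : Fin l → F.Carrierᴹ T {d}) →
            F._≈ᴹ_ T (Σ′.sum T (λ i → F._+ᴹ_ T (f i) (g i))) (F._+ᴹ_ T (Σ′.sum T f) (Σ′.sum T g))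
    sum-+ T = Σ′.∑-distrib-+ T

    sum-* : ∀ T s {l} (f : Fin l → F.Carrierᴹ T {d}) →
            F._≈ᴹ_ T (Σ′.sum T (λ i → F._*ₗ_ T s (f i))) (F._*ₗ_ T s (Σ′.sum T f))
    sum-* T s {zero}  f = F.≈ᴹ-sym T (F.*ₗ-zeroʳ T s)
    sum-* T s {suc l} f = F.≈ᴹ-trans T (F.+ᴹ-congˡ T (sum-* T s (f ∘ suc)))
      (F.≈ᴹ-sym T (F.*ₗ-distribˡ T s _ _))

    summand-cong : ∀ {x y} → x ≈ᴹ y → ∀ T .(p : T ∈Q) .(q : ∣ T ∣ ≡ suc k) e e∈? →
                   F._≈ᴹ_ T (summand x T p q e e∈?) (summand y T p q e e∈?)
    summand-cong x≈y T p q e (no _)    = F.≈ᴹ-refl T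
    summand-cong x≈y T p q e (yes e∈T) =
      F.*ₗ-congˡ T (LinearMap.⟦⟧-cong (map e (removal-⋖ e∈T) d) (x≈y (T - e) _ _))

    summand-+ : ∀ x y T .(p : T ∈Q) .(q : ∣ T ∣ ≡ suc k) e e∈? →
                F._≈ᴹ_ T (summand (x +ᴹ y) T p q e e∈?)
                         (F._+ᴹ_ T (summand x T p q e e∈?) (summand y T p q e e∈?))
    summand-+ x y T p q e (no _)    = F.≈ᴹ-sym T (F.+ᴹ-identityˡ T _)
    summand-+ x y T p q e (yes e∈T) = F.≈ᴹ-trans T
      (F.*ₗ-congˡ T (LinearMap.+ᴹ-homo (map e (removal-⋖ e∈T) d) _ _)) (F.*ₗ-distribˡ T _ _ _)

    summand-* : ∀ s x T .(p : T ∈Q) .(q : ∣ T ∣ ≡ suc k) e e∈? →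
                F._≈ᴹ_ T (summand (s *ₗ x) T p q e e∈?) (F._*ₗ_ T s (summand x T p q e e∈?))
    summand-* s x T p q e (no _)    = F.≈ᴹ-sym T (F.*ₗ-zeroʳ T s)
    summand-* s x T p q e (yes e∈T) = F.≈ᴹ-trans T
      (F.*ₗ-congˡ T (LinearMap.*ₗ-homo (map e (removal-⋖ e∈T) d) s _)) (F.*ₗ-comm T _ s _)

  coboundaries : ∀ k d → Submodule (cochains k d) (c ⊔ ℓc)
  coboundaries zero    d = zeroSubmodule (cochains zero d) (c ⊔ ℓc)
  coboundaries (suc k) d = image (δ k d)

cohomology : {R : CommutativeRing r ℓr} {m : ℕ} → CubeFunctor R m c ℓc → LowerOrderIdeal m →
             ℕ → GradedModule R (c ⊔ ℓc) (c ⊔ ℓc)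
cohomology F Q k d = subquotient (kernel (δ k d)) (coboundaries k d)
  where open Cochains F Q

module _ (G : OrderedGraph) where
  open OrderedGraph G
  open Spanning ends using (Joins)

  -- C is the edge set of the closed sequence x₁, …, x_len, x₁.
  record IsCycle (C : Subset edges) : Set where
    field
      extra : ℕ

    len : ℕ
    len = 3 ℕ.+ extra

    next : Fin len → Fin len
    next i = suc (toℕ i) mod len

    field
      x        : Fin len → Fin vertices
      distinct : Injective _≡_ _≡_ x
      edge     : Fin len → Fin edges
      joins    : ∀ i → Joins (edge i) (x i) (x (next i))
      edge-set : ∀ e → e ∈ C ⇔ (∃ λ i → edge i ≡ e)

  IsBrokenCircuit : Subset edges → Set
  IsBrokenCircuit B = ∃₂ λ (C : Subset edges) (e : Fin edges) →
    IsCycle C × e ∈ C × (∀ j → j ∈ C → j Fin.≤ e) × B ≡ C - e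

  NBC : LowerOrderIdeal edges
  NBC = record
    { Member = λ S → ∀ B → IsBrokenCircuit B → ¬ (B ⊆ S)
    ; down-closed = λ S⊆T nbc B broken B⊆S → nbc B broken (⊆-trans B⊆S S⊆T)
    }

{-# OPTIONS --safe #-}

-- Call an edge e active in S ⊆ E if its ends are joined by edges of S preceding e; S contains
-- a broken circuit iff some edge is active in it.  Inserting or deleting e changes neither
-- whether e is active nor whether an earlier edge is, and for e active in S the map
-- F(S ⋖ S ∪ {e}) is invertible, because e completes a cycle.  Hence for each e the sets whose
-- first active edge is e are matched in pairs S, S ∪ {e}, and the matching gives a homotopy
-- hₑ: a cocycle z vanishing where no edge up to e is active agrees with δ hₑ z wherever no
-- edge before e is active.  Subtracting δ hₑ z for e from last to first shows that every
-- cocycle of the cube which vanishes on NBC is the coboundary of a cochain which vanishes on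
-- NBC, so restricting cochains to NBC induces an isomorphism in cohomology.

module Submission where

open import Defs
open import Level using (Level; _⊔_; 0ℓ; lift) renaming (suc to lsuc)
open import Function.Base using (_∘_; id)
open import Function.Bundles using (_⇔_; mk⇔; Equivalence)
open import Function.Definitions using (Bijective; Injective)
open import Data.Unit.Base using (⊤; tt)
open import Data.Product.Base as Product using (∃; _×_; _,_; proj₁; proj₂)
open import Data.Product.Properties using (,-injective; ,-injectiveˡ; ,-injectiveʳ)
open import Data.Sum.Base using (_⊎_; inj₁; inj₂; [_,_]′)
open import Data.Nat.Base as ℕ using (ℕ; zero; suc; _%_)
import Data.Nat.Properties as ℕₚ
open import Data.Nat.DivMod
  using (_mod_; m<n⇒m%n≡m; n%n≡0; m%n%n≡m%n; %-distribˡ-+; [m+n]%n≡m%n; m%n<n)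
open import Data.Nat.GeneralisedArithmetic using (fold)
open import Data.Integer.Base using (ℤ)
open import Data.Fin.Base as Fin using (Fin; zero; suc; toℕ; fromℕ; fromℕ<; inject₁)
open import Data.Fin.Properties as Finₚ
  using (_≟_; _<?_; toℕ-fromℕ<; toℕ-injective; toℕ<n; toℕ-inject₁; toℕ-fromℕ)
open import Data.Fin.Relation.Unary.Top using (view; ‵fromℕ; ‵inject₁)
open import Data.Fin.Subset using (Subset; _∈_; _∉_; _⊆_; _∪_; _∩_; _-_; ⁅_⁆; ∣_∣)
open import Data.Fin.Subset.Properties
  using (_∈?_; x∈p∪q⁺; x∈p∪q⁻; x∈p∩q⁺; x∈p∩q⁻; p∩q⊆p; p─q⊆p; x∈⁅x⁆; x∈⁅y⁆⇒x≡y;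
         x∈p∧x≢y⇒x∈p-y; x∈p⇒∣p-x∣<∣p∣; ⊆-antisym)
open import Data.Vec.Base using (tabulate)
open import Data.Vec.Properties using (lookup∘tabulate; []=⇒lookup; lookup⇒[]=)
open import Relation.Nullary using (¬_; Dec; yes; no; does; contradiction)
open import Relation.Nullary.Decidable
  using (_×-dec_; _→-dec_; ¬?; map′; dec-true; recompute)
open import Relation.Nullary.Negation.Core using (contradiction-irr)
open import Relation.Binary.PropositionalEquality as ≡ using (_≡_; _≢_; refl; cong; subst)
open import Relation.Binary.PropositionalEquality.WithK using (≡-irrelevant)
open import Relation.Binary.Construct.Closure.ReflexiveTransitive using (ε; _◅_; _◅◅_)
import Relation.Binary.Reasoning.Setoid as SetoidReasoning
open import Algebra.Bundles using (CommutativeMonoid; CommutativeRing)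
open import Algebra.Module.Bundles using (Module)
import Algebra.Properties.CommutativeMonoid.Sum as Sums
import Algebra.Properties.AbelianGroup as AbelianGroupProperties
import Algebra.Properties.Semiring.Exp as SemiringExp
import Algebra.Properties.Ring as RingProperties

private
  variable
    r ℓr m ℓm c ℓ c′ ℓ′ ℓc : Level

-- Finite sums in commutative monoids

module _ (M : CommutativeMonoid c ℓ) where
  open CommutativeMonoid M
    renaming (ε to 0#; _∙_ to _+_; refl to ≈-refl; trans to ≈-trans)
  open Sums M using (sum; sum-cong-≋; sum-replicate-zero; ∑-distrib-+)
  open SetoidReasoning setoid

  sum-zero : ∀ {n} (t : Fin n → Carrier) → (∀ i → t i ≈ 0#) → sum t ≈ 0#
  sum-zero {n} t t≈0 = ≈-trans (sum-cong-≋ t≈0) (sum-replicate-zero n)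

  sum-single : ∀ {n} (t : Fin n → Carrier) i → (∀ j → j ≢ i → t j ≈ 0#) → sum t ≈ t i
  sum-single t zero    t≈0 = ≈-trans
    (∙-congˡ (sum-zero (t ∘ suc) λ j → t≈0 (suc j) λ ())) (identityʳ _)
  sum-single t (suc i) t≈0 = ≈-trans
    (∙-cong (t≈0 zero λ ())
      (sum-single (t ∘ suc) i λ j j≢i → t≈0 (suc j) (j≢i ∘ Finₚ.suc-injective)))
    (identityˡ _)

  -- By induction on the size: the first row and the first column cancel entry by entry. The
  -- diagonal is a separate hypothesis because x + x ≈ 0 need not give x ≈ 0.
  sum-antisymmetric : ∀ {n} (a : Fin n → Fin n → Carrier) → (∀ i → a i i ≈ 0#) →
                      (∀ i j → a i j + a j i ≈ 0#) → sum (λ i → sum (a i)) ≈ 0#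
  sum-antisymmetric {zero}  a diag anti = ≈-refl
  sum-antisymmetric {suc n} a diag anti = begin
    (a zero zero + row) + sum (λ i → a (suc i) zero + sum (a (suc i) ∘ suc))
      ≈⟨ ∙-cong (≈-trans (∙-congʳ (diag zero)) (identityˡ row))
           (∑-distrib-+ (λ i → a (suc i) zero) (λ i → sum (a (suc i) ∘ suc))) ⟩
    row + (column + sum (λ i → sum (a (suc i) ∘ suc)))
      ≈⟨ ∙-congˡ (≈-trans (∙-congˡ
           (sum-antisymmetric (λ i j → a (suc i) (suc j)) (diag ∘ suc)
             (λ i j → anti (suc i) (suc j))))
           (identityʳ column)) ⟩
    row + column
      ≈⟨ ∑-distrib-+ (λ i → a zero (suc i)) (λ i → a (suc i) zero) ⟨
    sum (λ i → a zero (suc i) + a (suc i) zero)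
      ≈⟨ sum-zero (λ i → a zero (suc i) + a (suc i) zero) (λ i → anti zero (suc i)) ⟩
    0# ∎
    where
    row    = sum (λ j → a zero (suc j))
    column = sum (λ i → a (suc i) zero)

module _ (M : CommutativeMonoid c ℓ) (N : CommutativeMonoid c′ ℓ′) where
  private
    module M = CommutativeMonoid M
    module N = CommutativeMonoid N

  sum-homo : (φ : M.Carrier → N.Carrier) → φ M.ε N.≈ N.ε →
             (∀ x y → φ (x M.∙ y) N.≈ φ x N.∙ φ y) →
             ∀ {n} (t : Fin n → M.Carrier) → φ (Sums.sum M t) N.≈ Sums.sum N (φ ∘ t)
  sum-homo φ φ-ε φ-∙ {zero}  t = φ-ε
  sum-homo φ φ-ε φ-∙ {suc n} t = N.trans (φ-∙ _ _) (N.∙-congˡ (sum-homo φ φ-ε φ-∙ (t ∘ suc)))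

-- Cover relations and their signs

module _ {n : ℕ} {p} {P : Fin n → Set p} (P? : ∀ i → Dec (P i)) where

  ∈-tabulate⁺ : ∀ {i} → P i → i ∈ tabulate (does ∘ P?)
  ∈-tabulate⁺ {i} Pi = lookup⇒[]= i _
    (≡.trans (lookup∘tabulate (does ∘ P?) i) (dec-true (P? i) Pi))

  ∈-tabulate⁻ : ∀ {i} → i ∈ tabulate (does ∘ P?) → P i
  ∈-tabulate⁻ {i} i∈ with P? i | ≡.trans (≡.sym (lookup∘tabulate (does ∘ P?) i)) ([]=⇒lookup i∈)
  ... | yes Pi | _ = Pi

module _ {m : ℕ} where

  x∉p-x : ∀ (S : Subset m) e → e ∉ S - e
  x∉p-x S e e∈S-e with e ∈? S
  ... | yes e∈S = proj₁ (removal-⋖ e∈S) e∈S-e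
  ... | no e∉S  = e∉S (p─q⊆p S ⁅ e ⁆ e∈S-e)

  x∈p-y⇒x≢y : ∀ {S : Subset m} {e f} → f ∈ S - e → f ≢ e
  x∈p-y⇒x≢y {S} {e} p refl = x∉p-x S e p

  ⋖-∈ : ∀ {S T : Subset m} {e} → S ⋖[ e ] T → e ∈ T
  ⋖-∈ {e = e} (_ , refl) = x∈p∪q⁺ (inj₂ (x∈⁅x⁆ e))

  ⋖-⊆ : ∀ {S T : Subset m} {e} → S ⋖[ e ] T → S ⊆ T
  ⋖-⊆ (_ , refl) f∈S = x∈p∪q⁺ (inj₁ f∈S)

  ⋖-⊆⁻ : ∀ {S T : Subset m} {e f} → S ⋖[ e ] T → f ∈ T → f ≢ e → f ∈ S
  ⋖-⊆⁻ {S} {e = e} (_ , refl) f∈T f≢e with x∈p∪q⁻ S ⁅ e ⁆ f∈T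
  ... | inj₁ f∈S = f∈S
  ... | inj₂ f∈e = contradiction (x∈⁅y⁆⇒x≡y e f∈e) f≢e

  ⋖-intro : ∀ {S T : Subset m} {e} → e ∉ S → e ∈ T → S ⊆ T →
            (∀ {f} → f ∈ T → f ≢ e → f ∈ S) → S ⋖[ e ] T
  ⋖-intro {S} {T} {e} e∉S e∈T S⊆T T⊆S = e∉S , ⊆-antisym to from
    where
    to : T ⊆ S ∪ ⁅ e ⁆
    to {f} f∈T with f ≟ e
    ... | yes refl = x∈p∪q⁺ (inj₂ (x∈⁅x⁆ e))
    ... | no f≢e   = x∈p∪q⁺ (inj₁ (T⊆S f∈T f≢e))
    from : S ∪ ⁅ e ⁆ ⊆ T
    from f∈ with x∈p∪q⁻ S ⁅ e ⁆ f∈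
    ... | inj₁ f∈S = S⊆T f∈S
    ... | inj₂ f∈e = subst (_∈ T) (≡.sym (x∈⁅y⁆⇒x≡y e f∈e)) e∈T

  ⋖⇒≡- : ∀ {S T : Subset m} {e} → S ⋖[ e ] T → S ≡ T - e
  ⋖⇒≡- {S} {T} {e} S⋖T = ⊆-antisym
    (λ f∈S → x∈p∧x≢y⇒x∈p-y (⋖-⊆ S⋖T f∈S) λ { refl → proj₁ S⋖T f∈S })
    (λ f∈ → ⋖-⊆⁻ S⋖T (p─q⊆p T ⁅ e ⁆ f∈) (x∈p-y⇒x≢y f∈))

  -- The map of a cover relation takes the proof of the relation as an argument, so different proofs
  -- must be identified before maps can be compared. Proofs of `e ∉ S` already agree definitionally.
  ⋖-irrelevant : ∀ {S T : Subset m} {e} (p q : S ⋖[ e ] T) → p ≡ q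
  ⋖-irrelevant (e∉S , p) (_ , q) = cong (e∉S ,_) (≡-irrelevant p q)

  ⋖-size : ∀ {S T : Subset m} {e} → S ⋖[ e ] T → ∣ T ∣ ≡ suc ∣ S ∣
  ⋖-size S⋖T = ≡.trans (≡.sym (∣removal∣ (⋖-∈ S⋖T))) (cong (suc ∘ ∣_∣) (≡.sym (⋖⇒≡- S⋖T)))

  ⋖-size⁺ : ∀ {S T : Subset m} {e k} → S ⋖[ e ] T → ∣ S ∣ ≡ k → ∣ T ∣ ≡ suc k
  ⋖-size⁺ S⋖T q = ≡.trans (⋖-size S⋖T) (cong suc q)

  ⋖-size⁻ : ∀ {S T : Subset m} {e k} → S ⋖[ e ] T → ∣ T ∣ ≡ suc k → ∣ S ∣ ≡ k
  ⋖-size⁻ S⋖T q = ℕₚ.suc-injective (≡.trans (≡.sym (⋖-size S⋖T)) q)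

  ⋖-remove : ∀ {S T : Subset m} {e f} → S ⋖[ e ] T → e ≢ f → S - f ⋖[ e ] T - f
  ⋖-remove {S} {T} {e} {f} S⋖T e≢f = ⋖-intro
    (proj₁ S⋖T ∘ p─q⊆p S ⁅ f ⁆)
    (x∈p∧x≢y⇒x∈p-y (⋖-∈ S⋖T) e≢f)
    (λ g∈ → x∈p∧x≢y⇒x∈p-y (⋖-⊆ S⋖T (p─q⊆p S ⁅ f ⁆ g∈)) (x∈p-y⇒x≢y g∈))
    (λ g∈ g≢e → x∈p∧x≢y⇒x∈p-y (⋖-⊆⁻ S⋖T (p─q⊆p T ⁅ f ⁆ g∈) g≢e) (x∈p-y⇒x≢y g∈))

  ∈-before⁺ : ∀ {i j : Fin m} → j Fin.< i → j ∈ before i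
  ∈-before⁺ {i} = ∈-tabulate⁺ (_<? i)

  ∈-before⁻ : ∀ {i j : Fin m} → j ∈ before i → j Fin.< i
  ∈-before⁻ {i} = ∈-tabulate⁻ (_<? i)

  ⋖-before-≮ : ∀ {S T : Subset m} {e i} → S ⋖[ e ] T → ¬ e Fin.< i → S ∩ before i ≡ T ∩ before i
  ⋖-before-≮ {S} {T} {e} {i} S⋖T e≮i = ⊆-antisym to from
    where
    to : S ∩ before i ⊆ T ∩ before i
    to f∈ = let f∈S , f<i = x∈p∩q⁻ S (before i) f∈ in x∈p∩q⁺ (⋖-⊆ S⋖T f∈S , f<i)
    from : T ∩ before i ⊆ S ∩ before i
    from f∈ = let f∈T , f<i = x∈p∩q⁻ T (before i) f∈ in
      x∈p∩q⁺ (⋖-⊆⁻ S⋖T f∈T (λ { refl → e≮i (∈-before⁻ f<i) }) , f<i)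

  ⋖-before-< : ∀ {S T : Subset m} {e i} → S ⋖[ e ] T → e Fin.< i →
               S ∩ before i ⋖[ e ] T ∩ before i
  ⋖-before-< {S} {T} {e} {i} S⋖T e<i = ⋖-intro
    (proj₁ S⋖T ∘ proj₁ ∘ x∈p∩q⁻ S (before i))
    (x∈p∩q⁺ (⋖-∈ S⋖T , ∈-before⁺ e<i))
    (λ f∈ → let f∈S , f<i = x∈p∩q⁻ S (before i) f∈ in x∈p∩q⁺ (⋖-⊆ S⋖T f∈S , f<i))
    (λ f∈ f≢e → let f∈T , f<i = x∈p∩q⁻ T (before i) f∈ in x∈p∩q⁺ (⋖-⊆⁻ S⋖T f∈T f≢e , f<i))

module _ (R : CommutativeRing c ℓ) where
  open CommutativeRing R using (Carrier; _≈_; _+_; _*_; -_; 0#; 1#; semiring; ring; setoid)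
  private
    module R = CommutativeRing R
  open SemiringExp semiring using (_^_)
  open RingProperties ring using (-1*x≈-x; -‿distribˡ-*; -‿distribʳ-*; -‿involutive)

  [-1]^n*[-1]^n≈1 : ∀ n → (- 1#) ^ n * (- 1#) ^ n ≈ 1#
  [-1]^n*[-1]^n≈1 zero    = R.*-identityˡ 1#
  [-1]^n*[-1]^n≈1 (suc n) = begin
    (- 1# * x) * (- 1# * x)  ≈⟨ R.*-cong (-1*x≈-x x) (-1*x≈-x x) ⟩
    - x * - x                ≈⟨ -‿distribˡ-* x (- x) ⟨
    - (x * - x)              ≈⟨ R.-‿cong (-‿distribʳ-* x x) ⟨
    - - (x * x)              ≈⟨ -‿involutive (x * x) ⟩
    x * x                    ≈⟨ [-1]^n*[-1]^n≈1 n ⟩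
    1#                       ∎
    where
    open SetoidReasoning setoid
    x = (- 1#) ^ n

  module _ {m : ℕ} where
    private
      sign : Subset m → Fin m → Carrier
      sign S i = (- 1#) ^ ∣ S ∩ before i ∣

    sign-< : ∀ {S T e i} → S ⋖[ e ] T → e Fin.< i → sign T i ≈ - sign S i
    sign-< {S} {T} {e} {i} S⋖T e<i = R.trans
      (R.reflexive (cong ((- 1#) ^_) (⋖-size (⋖-before-< {i = i} S⋖T e<i)))) (-1*x≈-x _)

    sign-≮ : ∀ {S T e i} → S ⋖[ e ] T → ¬ e Fin.< i → sign T i ≈ sign S i
    sign-≮ {S} {T} {e} {i} S⋖T e≮i =
      R.reflexive (cong (λ U → (- 1#) ^ ∣ U ∣) (≡.sym (⋖-before-≮ {i = i} S⋖T e≮i)))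

    -- Only the later of the two edges sees the other one before it, so exactly one of `sign S e`
    -- and `sign T f` is opposite to its value on `U`.
    sign-anticommute : ∀ {U S T e f} → e ≢ f → U ⋖[ f ] S → U ⋖[ e ] T →
                       sign S e * sign U f + sign T f * sign U e ≈ 0#
    sign-anticommute {U} {S} {T} {e} {f} e≢f U⋖S U⋖T with e <? f
    ... | yes e<f = R.trans
      (R.+-cong (R.*-congʳ (sign-≮ U⋖S (ℕₚ.<-asym e<f)))
        (R.trans (R.*-congʳ (sign-< U⋖T e<f))
          (R.trans (R.sym (-‿distribˡ-* _ _)) (R.-‿cong (R.*-comm _ _)))))
      (R.-‿inverseʳ _)
    ... | no e≮f = R.trans
      (R.+-cong
        (R.trans
          (R.*-congʳ (sign-< U⋖S (ℕₚ.≤∧≢⇒< (ℕₚ.≮⇒≥ e≮f) (e≢f ∘ ≡.sym ∘ toℕ-injective))))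
          (R.trans (R.sym (-‿distribˡ-* _ _)) (R.-‿cong (R.*-comm _ _))))
        (R.*-congʳ (sign-≮ U⋖T e≮f)))
      (R.-‿inverseˡ _)

    -- The previous identity multiplied by `sign U e`, whose square is 1. The homotopy contributes
    -- this extra sign to one of the two terms.
    sign-anticommute′ : ∀ {U S T e f} → e ≢ f → U ⋖[ f ] S → U ⋖[ e ] T →
                        sign T f + sign S e * (sign U f * sign U e) ≈ 0#
    sign-anticommute′ {U} {S} {T} {e} {f} e≢f U⋖S U⋖T = begin
      sign T f + sign S e * (sign U f * b)
        ≈⟨ R.+-congʳ (R.*-identityʳ _) ⟨
      sign T f * 1# + sign S e * (sign U f * b)
        ≈⟨ R.+-congʳ (R.*-congˡ ([-1]^n*[-1]^n≈1 ∣ U ∩ before e ∣)) ⟨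
      sign T f * (b * b) + sign S e * (sign U f * b)
        ≈⟨ R.+-cong (R.*-assoc _ b b) (R.*-assoc _ _ b) ⟨
      (sign T f * b) * b + (sign S e * sign U f) * b
        ≈⟨ R.distribʳ b _ _ ⟨
      (sign T f * b + sign S e * sign U f) * b
        ≈⟨ R.*-congʳ (R.+-comm _ _) ⟩
      (sign S e * sign U f + sign T f * b) * b
        ≈⟨ R.*-congʳ (sign-anticommute e≢f U⋖S U⋖T) ⟩
      0# * b
        ≈⟨ R.zeroˡ b ⟩
      0# ∎
      where
      open SetoidReasoning setoid
      b = sign U e

-- The complex of a functor on the cube

module CubeComplex {R : CommutativeRing r ℓr} {m : ℕ} (F : CubeFunctor R m c ℓc) (d : ℤ) where
  open CommutativeRing R using (Carrier; _+_; _*_; 0#)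
  open CubeFunctor F
  open Cochains F wholeCube
  private
    module F S = Module (obj S d)
    module Σ′ S = Sums (F.+ᴹ-commutativeMonoid S)

  Φ : ∀ {S T e} → S ⋖[ e ] T → F.Carrierᴹ S → F.Carrierᴹ T
  Φ {e = e} s = LinearMap.fun (map e s d)

  private
    module Φ {S T e} (s : S ⋖[ e ] T) = LinearMap (map e s d)

  scaled-sum : ∀ {S T e} (a : Carrier) (s : S ⋖[ e ] T) {n} (t : Fin n → F.Carrierᴹ S) →
               F._≈ᴹ_ T (F._*ₗ_ T a (Φ s (Σ′.sum S t))) (Σ′.sum T (λ i → F._*ₗ_ T a (Φ s (t i))))
  scaled-sum {S} {T} a s = sum-homo (F.+ᴹ-commutativeMonoid S) (F.+ᴹ-commutativeMonoid T) _
    (F.≈ᴹ-trans T (F.*ₗ-congˡ T (Φ.0ᴹ-homo s)) (F.*ₗ-zeroʳ T a))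
    (λ x y → F.≈ᴹ-trans T (F.*ₗ-congˡ T (Φ.+ᴹ-homo s x y)) (F.*ₗ-distribˡ T a _ _))

  scaled-zero : ∀ {S T e} (a : Carrier) (s : S ⋖[ e ] T) {x} → F._≈ᴹ_ S x (F.0ᴹ S) →
                F._≈ᴹ_ T (F._*ₗ_ T a (Φ s x)) (F.0ᴹ T)
  scaled-zero {S} {T} a s x≈0 = F.≈ᴹ-trans T
    (F.*ₗ-congˡ T (F.≈ᴹ-trans T (Φ.⟦⟧-cong s x≈0) (Φ.0ᴹ-homo s))) (F.*ₗ-zeroʳ T a)

  module _ {k} (x : Cochain k d) where

    summand-∉ : ∀ {T} .(q : ∣ T ∣ ≡ suc k) {e} → e ∉ T → (e∈? : Dec (e ∈ T)) →
                F._≈ᴹ_ T (summand x T tt q e e∈?) (F.0ᴹ T)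
    summand-∉ {T} q e∉T (yes e∈T) = contradiction e∈T e∉T
    summand-∉ {T} q e∉T (no _)    = F.≈ᴹ-refl T

    -- The differential is written with `T - e` and the proof `removal-⋖`; this frees later
    -- computations from both, so that the corners of a square can be presented as convenient.
    summand-⋖ : ∀ {S T e} (s : S ⋖[ e ] T) .(p : ∣ S ∣ ≡ k) .(q : ∣ T ∣ ≡ suc k)
                (e∈? : Dec (e ∈ T)) →
                F._≈ᴹ_ T (summand x T tt q e e∈?) (F._*ₗ_ T (sign S e) (Φ s (x S tt p)))
    summand-⋖ s p q (no e∉T) = contradiction (⋖-∈ s) e∉T
    summand-⋖ {T = T} s p q (yes e∈T) with ⋖⇒≡- s
    ... | refl with ⋖-irrelevant s (removal-⋖ e∈T)
    ...   | refl = F.≈ᴹ-refl T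

  module _ {k} (x : Cochain k d) (T : Subset m) .(q : ∣ T ∣ ≡ suc (suc k)) where
    private
      -- The term of δδ that comes from removing `f` and then `g`. It is extended by 0 to all pairs
      -- of indices to form a square array for `sum-antisymmetric`.
      entry : ∀ f g → Dec (f ∈ T) → F.Carrierᴹ T
      entry f g (no _)    = F.0ᴹ T
      entry f g (yes f∈T) = F._*ₗ_ T (sign (T - f) f) (Φ (removal-⋖ f∈T)
        (summand x (T - f) tt (ℕₚ.suc-injective (≡.trans (∣removal∣ f∈T) q)) g (g ∈? (T - f))))

      δδ-summand : ∀ f f∈? → F._≈ᴹ_ T (summand (δ-fun k d x) T tt q f f∈?)
                                      (Σ′.sum T (λ g → entry f g f∈?))
      δδ-summand f (no _)    = F.≈ᴹ-sym T (Σ′.sum-replicate-zero T m)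
      δδ-summand f (yes f∈T) = scaled-sum (sign (T - f) f) (removal-⋖ f∈T) λ g →
        summand x (T - f) tt (ℕₚ.suc-injective (≡.trans (∣removal∣ f∈T) q)) g (g ∈? (T - f))

      entry-∉ : ∀ f g f∈? → (f ∈ T → g ∉ T - f) → F._≈ᴹ_ T (entry f g f∈?) (F.0ᴹ T)
      entry-∉ f g (no _)    g∉ = F.≈ᴹ-refl T
      entry-∉ f g (yes f∈T) g∉ = scaled-zero (sign (T - f) f) (removal-⋖ f∈T)
        (summand-∉ x _ (g∉ f∈T) (g ∈? (T - f)))

      entry-⋖ : ∀ {U S f g} (s : U ⋖[ g ] S) (t : S ⋖[ f ] T) .(p : ∣ U ∣ ≡ k) f∈? →
                F._≈ᴹ_ T (entry f g f∈?)
                  (F._*ₗ_ T (sign S f * sign U g) (Φ t (Φ s (x U tt p))))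
      entry-⋖ s t p (no f∉T) = contradiction (⋖-∈ t) f∉T
      entry-⋖ {U} {S} {f} {g} s t p (yes f∈T) with ⋖⇒≡- t
      ... | refl with ⋖-irrelevant t (removal-⋖ f∈T)
      ...   | refl = F.≈ᴹ-trans T
        (F.*ₗ-congˡ T (F.≈ᴹ-trans T (Φ.⟦⟧-cong t (summand-⋖ x s p _ (g ∈? S)))
          (Φ.*ₗ-homo t (sign U g) _)))
        (F.≈ᴹ-sym T (F.*ₗ-assoc T (sign S f) (sign U g) _))

      entry-diagonal : ∀ f → F._≈ᴹ_ T (entry f f (f ∈? T)) (F.0ᴹ T)
      entry-diagonal f = entry-∉ f f (f ∈? T) λ _ → x∉p-x T f

      -- The two terms follow the two sides of the square from `T` without `f` and `g` up to `T`:
      -- the maps agree since the square commutes, and the signs are opposite.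
      entry-antisymmetric : ∀ f g →
        F._≈ᴹ_ T (F._+ᴹ_ T (entry f g (f ∈? T)) (entry g f (g ∈? T))) (F.0ᴹ T)
      entry-antisymmetric f g with f ≟ g
      ... | yes refl = F.≈ᴹ-trans T
        (F.+ᴹ-cong T (entry-diagonal f) (entry-diagonal f)) (F.+ᴹ-identityˡ T _)
      ... | no f≢g = go (f ∈? T) (g ∈? T)
        where
        go : ∀ f∈? g∈? → F._≈ᴹ_ T (F._+ᴹ_ T (entry f g f∈?) (entry g f g∈?)) (F.0ᴹ T)
        go (no f∉T) g∈? = F.≈ᴹ-trans T (F.+ᴹ-identityˡ T _)
          (entry-∉ g f g∈? λ _ → f∉T ∘ p─q⊆p T ⁅ g ⁆)
        go f∈?@(yes _) (no g∉T) = F.≈ᴹ-trans T (F.+ᴹ-identityʳ T _)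
          (entry-∉ f g f∈? λ _ → g∉T ∘ p─q⊆p T ⁅ f ⁆)
        go f∈?@(yes f∈T) g∈?@(yes g∈T) = begin
          entry f g f∈? ⊕ entry g f g∈?
            ≈⟨ F.+ᴹ-cong T (entry-⋖ s t (⋖-size⁻ s (⋖-size⁻ t q)) f∈?)
                 (entry-⋖ s′ t′ (⋖-size⁻ s (⋖-size⁻ t q)) g∈?) ⟩
          (sign (T - f) f * sign U g) · Φ t (Φ s y) ⊕ (sign (T - g) g * sign U f) · Φ t′ (Φ s′ y)
            ≈⟨ F.+ᴹ-congˡ T (F.*ₗ-congˡ T (square s′ t′ s t d y)) ⟩
          (sign (T - f) f * sign U g) · Φ t (Φ s y) ⊕ (sign (T - g) g * sign U f) · Φ t (Φ s y)
            ≈⟨ F.*ₗ-distribʳ T _ _ _ ⟨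
          (sign (T - f) f * sign U g + sign (T - g) g * sign U f) · Φ t (Φ s y)
            ≈⟨ F.*ₗ-congʳ T (sign-anticommute R f≢g s s′) ⟩
          0# · Φ t (Φ s y)
            ≈⟨ F.*ₗ-zeroˡ T _ ⟩
          F.0ᴹ T ∎
          where
          open SetoidReasoning (F.≈ᴹ-setoid T)
          open Module (obj T d) using () renaming (_+ᴹ_ to infixl 6 _⊕_; _*ₗ_ to infixr 7 _·_)
          U = (T - f) - g
          s : U ⋖[ g ] T - f
          s = removal-⋖ (x∈p∧x≢y⇒x∈p-y g∈T (f≢g ∘ ≡.sym))
          t : T - f ⋖[ f ] T
          t = removal-⋖ f∈T
          s′ : U ⋖[ f ] T - g
          -- Deleting `g` from both ends of `t` yields the fourth side with `U` as its bottom, so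
          -- the two orders of removal need not be compared as sets.
          s′ = ⋖-remove t f≢g
          t′ : T - g ⋖[ g ] T
          t′ = removal-⋖ g∈T
          y = x U tt (⋖-size⁻ s (⋖-size⁻ t q))

    δδ≈0 : F._≈ᴹ_ T (δ-fun (suc k) d (δ-fun k d x) T tt q) (F.0ᴹ T)
    δδ≈0 = F.≈ᴹ-trans T (Σ′.sum-cong-≋ T (λ f → δδ-summand f (f ∈? T)))
      (sum-antisymmetric (F.+ᴹ-commutativeMonoid T) (λ f g → entry f g (f ∈? T))
        entry-diagonal entry-antisymmetric)

-- Modelled on "e closes a cycle with earlier edges of S".
record Activity {R : CommutativeRing r ℓr} {m : ℕ} (F : CubeFunctor R m c ℓc) :
                Set (lsuc 0ℓ ⊔ c ⊔ ℓc) where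
  open CubeFunctor F
  field
    Active    : Fin m → Subset m → Set
    active?   : ∀ e S → Dec (Active e S)
    mono      : ∀ {e S T} → S ⊆ T → Active e S → Active e T
    -- The bound is weak so as to include f = e: both members of a pair S, S ∪ {e} then have the
    -- same status for `e` and for all earlier edges.
    toggle    : ∀ {e f S T} → S ⋖[ f ] T → e Fin.≤ f → Active e T → Active e S
    -- This settles degree 0, where the only set is the empty one and there are no coboundaries to
    -- subtract.
    nonempty  : ∀ {e S} → Active e S → ∣ S ∣ ≢ 0
    bijective : ∀ {e S T} → Active e S → (s : S ⋖[ e ] T) → ∀ d →
                Bijective (Module._≈ᴹ_ (obj S d)) (Module._≈ᴹ_ (obj T d))
                  (LinearMap.fun (map e s d))

-- The matching by first active edges and its homotopies

module Matching {R : CommutativeRing r ℓr} {m : ℕ} (F : CubeFunctor R m c ℓc)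
                (activity : Activity F) (d : ℤ) where
  open CommutativeRing R using (_+_; _*_; 0#; 1#)
  open Activity activity
  open CubeFunctor F
  open Cochains F wholeCube
  open CubeComplex F d
  private
    module F S = Module (obj S d)
    module Σ′ S = Sums (F.+ᴹ-commutativeMonoid S)
    module C {k} = Module (cochains k d)
    module Φ {S T e} (s : S ⋖[ e ] T) = LinearMap (map e s d)
    module δ {k} = LinearMap (δ k d)

  δ-difference : ∀ {k} (z : Cochain (suc k) d) (w : Cochain k d) →
                 δ.fun z C.≈ᴹ C.0ᴹ → δ.fun (z C.+ᴹ C.-ᴹ δ.fun w) C.≈ᴹ C.0ᴹ
  δ-difference {k} z w δz≈0 = begin
    δ.fun (z C.+ᴹ C.-ᴹ δ.fun w)             ≈⟨ δ.+ᴹ-homo z (C.-ᴹ δ.fun w) ⟩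
    δ.fun z C.+ᴹ δ.fun (C.-ᴹ δ.fun w)       ≈⟨ C.+ᴹ-cong δz≈0 (δ.-ᴹ-homo (δ.fun w)) ⟩
    C.0ᴹ C.+ᴹ C.-ᴹ δ.fun (δ.fun w)          ≈⟨ C.+ᴹ-identityˡ _ ⟩
    C.-ᴹ δ.fun (δ.fun w)                    ≈⟨ C.-ᴹ‿cong (λ T _ q → δδ≈0 w T q) ⟩
    C.-ᴹ C.0ᴹ                               ≈⟨ ε⁻¹≈ε ⟩
    C.0ᴹ                                    ∎
    where
    open SetoidReasoning (C.≈ᴹ-setoid {2 ℕ.+ k})
    open AbelianGroupProperties (C.+ᴹ-abelianGroup {2 ℕ.+ k}) using (ε⁻¹≈ε)

  -- The bound is a natural number and not an edge, so that it can reach m, where no edge at all is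
  -- active.
  InactiveBelow : ℕ → Subset m → Set
  InactiveBelow j S = ∀ i → toℕ i ℕ.< j → ¬ Active i S

  inactiveBelow? : ∀ j S → Dec (InactiveBelow j S)
  inactiveBelow? j S = Finₚ.all? λ i → (toℕ i ℕₚ.<? j) →-dec ¬? (active? i S)

  inactiveBelow-⊆ : ∀ {j S T} → S ⊆ T → InactiveBelow j T → InactiveBelow j S
  inactiveBelow-⊆ S⊆T inactive i i<j = inactive i i<j ∘ mono S⊆T

  inactiveBelow-⋖ : ∀ {e S T} → S ⋖[ e ] T → InactiveBelow (toℕ e) S → InactiveBelow (toℕ e) T
  inactiveBelow-⋖ s inactive i i<e = inactive i i<e ∘ toggle s (ℕₚ.<⇒≤ i<e)

  inactiveBelow-suc : ∀ {e S} → InactiveBelow (toℕ e) S → ¬ Active e S →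
                      InactiveBelow (suc (toℕ e)) S
  inactiveBelow-suc {e} inactive ¬active i (ℕ.s≤s i≤e) with i ≟ e
  ... | yes refl = ¬active
  ... | no i≢e   = inactive i (ℕₚ.≤∧≢⇒< i≤e (i≢e ∘ toℕ-injective))

  VanishesOn : (Subset m → Set) → ∀ {k} → Cochain k d → Set ℓc
  VanishesOn Q {k} x = ∀ S → Q S → .(p : ∣ S ∣ ≡ k) → F._≈ᴹ_ S (x S tt p) (F.0ᴹ S)

  module _ (e : Fin m) where

    -- S is the lower member of a matched pair S, S ∪ {e}.
    FirstActive : Subset m → Set
    FirstActive S = InactiveBelow (toℕ e) S × Active e S × e ∉ S

    firstActive? : ∀ S → Dec (FirstActive S)
    firstActive? S = inactiveBelow? (toℕ e) S ×-dec (active? e S ×-dec ¬? (e ∈? S))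

    -- On lower members this inverts the component of δ from S to S ∪ {e}: the map by its
    -- bijectivity, the sign because it is its own inverse. All other sets receive 0.
    homotopy′ : ∀ {k} → Cochain (suc k) d → ∀ S → .(∣ S ∣ ≡ k) →
                Dec (FirstActive S) → F.Carrierᴹ S
    homotopy′ x S p (no _) = F.0ᴹ S
    homotopy′ x S p (yes (_ , active , e∉S)) = F._*ₗ_ S (sign S e)
      (proj₁ (proj₂ (bijective active s d) (x (S ∪ ⁅ e ⁆) tt (⋖-size⁺ s p))))
      where
      s : S ⋖[ e ] S ∪ ⁅ e ⁆
      s = e∉S , refl

    homotopy : ∀ {k} → Cochain (suc k) d → Cochain k d
    homotopy x S _ p = homotopy′ x S p (firstActive? S)

    homotopy-0 : ∀ {k} (x : Cochain (suc k) d) {S} .(p : ∣ S ∣ ≡ k) → ¬ FirstActive S →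
                 F._≈ᴹ_ S (homotopy x S tt p) (F.0ᴹ S)
    homotopy-0 x {S} p ¬first with firstActive? S
    ... | yes first = contradiction first ¬first
    ... | no _      = F.≈ᴹ-refl S

    homotopy-⋖ : ∀ {k} (x : Cochain (suc k) d) {S T} (s : S ⋖[ e ] T)
                 .(p : ∣ S ∣ ≡ k) .(q : ∣ T ∣ ≡ suc k) → InactiveBelow (toℕ e) S → Active e S →
                 F._≈ᴹ_ T (Φ s (homotopy x S tt p)) (F._*ₗ_ T (sign S e) (x T tt q))
    homotopy-⋖ x {S} {T} s@(e∉S , refl) p q inactive active with firstActive? S
    ... | no ¬first = contradiction (inactive , active , e∉S) ¬first
    ... | yes (_ , active′ , _) = F.≈ᴹ-trans T (Φ.*ₗ-homo s (sign S e) _)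
      (F.*ₗ-congˡ T (proj₂ (proj₂ (bijective active′ s d) _) (F.≈ᴹ-refl S)))

    module _ {k} (z : Cochain (suc k) d) (δz≈0 : δ.fun z C.≈ᴹ C.0ᴹ)
             (z-vanishes : VanishesOn (InactiveBelow (suc (toℕ e))) z) where

      private
        hz : Cochain k d
        hz = homotopy z

        -- Both sides are zero: `z` by hypothesis, and `hz` on each `S - f` because `e` stays
        -- inactive in subsets of `S`.
        inactive-case : ∀ S .(p : ∣ S ∣ ≡ suc k) → InactiveBelow (toℕ e) S → ¬ Active e S →
                        F._≈ᴹ_ S (z S tt p) (δ-fun k d hz S tt p)
        inactive-case S p inactive ¬active = F.≈ᴹ-trans S
          (z-vanishes S (inactiveBelow-suc inactive ¬active) p)
          (F.≈ᴹ-sym S (sum-zero (F.+ᴹ-commutativeMonoid S) _ λ f → zero-summand f (f ∈? S)))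
          where
          zero-summand : ∀ f f∈? → F._≈ᴹ_ S (summand hz S tt p f f∈?) (F.0ᴹ S)
          zero-summand f (no _)    = F.≈ᴹ-refl S
          zero-summand f (yes f∈S) = scaled-zero (sign (S - f) f) (removal-⋖ f∈S)
            (homotopy-0 z _ λ (_ , active , _) → ¬active (mono (p─q⊆p S ⁅ f ⁆) active))

        -- For f ≠ e the set `T - f` still contains `e` and is no lower member, so only the matched
        -- term of δ survives, and there `homotopy` undoes the map.
        member-case : ∀ T .(q : ∣ T ∣ ≡ suc k) → InactiveBelow (toℕ e) T → Active e T → e ∈ T →
                      F._≈ᴹ_ T (z T tt q) (δ-fun k d hz T tt q)
        member-case T q inactive active e∈T = begin
          z T tt q
            ≈⟨ F.*ₗ-identityˡ T _ ⟨
          1# · z T tt q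
            ≈⟨ F.*ₗ-congʳ T ([-1]^n*[-1]^n≈1 R ∣ S ∩ before e ∣) ⟨
          (sign S e * sign S e) · z T tt q
            ≈⟨ F.*ₗ-assoc T (sign S e) (sign S e) _ ⟩
          sign S e · sign S e · z T tt q
            ≈⟨ F.*ₗ-congˡ T (homotopy-⋖ z s (⋖-size⁻ s q) q
                 (inactiveBelow-⊆ (⋖-⊆ s) inactive) (toggle s ℕₚ.≤-refl active)) ⟨
          sign S e · Φ s (hz S tt _)
            ≈⟨ summand-⋖ hz s _ q (e ∈? T) ⟨
          summand hz T tt q e (e ∈? T)
            ≈⟨ sum-single (F.+ᴹ-commutativeMonoid T) (λ f → summand hz T tt q f (f ∈? T)) e
                 (λ f f≢e → zero-summand f f≢e (f ∈? T)) ⟨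
          δ-fun k d hz T tt q ∎
          where
          open SetoidReasoning (F.≈ᴹ-setoid T)
          open Module (obj T d) using () renaming (_*ₗ_ to infixr 7 _·_)
          S = T - e
          s : S ⋖[ e ] T
          s = removal-⋖ e∈T
          zero-summand : ∀ f → f ≢ e → ∀ f∈? → F._≈ᴹ_ T (summand hz T tt q f f∈?) (F.0ᴹ T)
          zero-summand f f≢e (no _)    = F.≈ᴹ-refl T
          zero-summand f f≢e (yes f∈T) = scaled-zero (sign (T - f) f) (removal-⋖ f∈T)
            (homotopy-0 z _ λ (_ , _ , e∉) → e∉ (x∈p∧x≢y⇒x∈p-y e∈T (f≢e ∘ ≡.sym)))

        -- Φ s is injective and δ z vanishes at T = S ∪ ⁅ e ⁆, so it suffices that the terms
        -- f ≠ e of (δ z)(T) and of Φ s ((δ hz)(S)) cancel, up to the sign of S ⋖ T.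
        nonmember-case : ∀ S .(p : ∣ S ∣ ≡ suc k) → InactiveBelow (toℕ e) S → Active e S → e ∉ S →
                         F._≈ᴹ_ S (z S tt p) (δ-fun k d hz S tt p)
        nonmember-case S p inactive active e∉S = proj₁ (bijective active s d) (begin
          Φ s (z S tt p)
            ≈⟨ F.*ₗ-identityˡ T _ ⟨
          1# · Φ s (z S tt p)
            ≈⟨ F.*ₗ-congʳ T σσ≈1 ⟨
          (σ * σ) · Φ s (z S tt p)
            ≈⟨ F.*ₗ-assoc T σ σ _ ⟩
          σ · σ · Φ s (z S tt p)
            ≈⟨ F.*ₗ-congˡ T total ⟨
          σ · (Σ′.sum T t ⊕ σ · Φ s (Σ′.sum S u))
            ≈⟨ F.*ₗ-congˡ T (F.≈ᴹ-trans T
                 (F.+ᴹ-congʳ T (δz≈0 T tt (⋖-size⁺ s p))) (F.+ᴹ-identityˡ T _)) ⟩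
          σ · σ · Φ s (Σ′.sum S u)
            ≈⟨ F.*ₗ-assoc T σ σ _ ⟨
          (σ * σ) · Φ s (Σ′.sum S u)
            ≈⟨ F.*ₗ-congʳ T σσ≈1 ⟩
          1# · Φ s (Σ′.sum S u)
            ≈⟨ F.*ₗ-identityˡ T _ ⟩
          Φ s (Σ′.sum S u) ∎)
          where
          T = S ∪ ⁅ e ⁆
          s : S ⋖[ e ] T
          s = e∉S , refl
          open SetoidReasoning (F.≈ᴹ-setoid T)
          open Module (obj T d) using ()
            renaming (_≈ᴹ_ to infix 4 _≈ᵀ_; _+ᴹ_ to infixl 6 _⊕_; _*ₗ_ to infixr 7 _·_)
          σ = sign S e
          σσ≈1 = [-1]^n*[-1]^n≈1 R ∣ S ∩ before e ∣
          t : Fin m → F.Carrierᴹ T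
          t f = summand z T tt (⋖-size⁺ s p) f (f ∈? T)
          u : Fin m → F.Carrierᴹ S
          u f = summand hz S tt p f (f ∈? S)

          diagonal : t e ⊕ σ · Φ s (u e) ≈ᵀ σ · Φ s (z S tt p)
          diagonal = F.≈ᴹ-trans T
            (F.+ᴹ-cong T (summand-⋖ z s p _ (e ∈? T))
              (scaled-zero σ s (summand-∉ hz p e∉S (e ∈? S))))
            (F.+ᴹ-identityʳ T _)

          cancel : ∀ f → f ≢ e → Dec (f ∈ S) → t f ⊕ σ · Φ s (u f) ≈ᵀ F.0ᴹ T
          cancel f f≢e (no f∉S) = F.≈ᴹ-trans T
            (F.+ᴹ-cong T (summand-∉ z _ (λ f∈T → f∉S (⋖-⊆⁻ s f∈T f≢e)) (f ∈? T))
              (scaled-zero σ s (summand-∉ hz p f∉S (f ∈? S))))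
            (F.+ᴹ-identityʳ T _)
          cancel f f≢e (yes f∈S) = F.≈ᴹ-trans T
            (F.+ᴹ-cong T (summand-⋖ z a′ (⋖-size⁺ b (⋖-size⁻ a p)) _ (f ∈? T))
              (F.*ₗ-congˡ T (Φ.⟦⟧-cong s (summand-⋖ hz a (⋖-size⁻ a p) p (f ∈? S)))))
            (by-activity (active? e U))
            where
            U  = S - f
            T′ = T - f
            a : U ⋖[ f ] S
            a = removal-⋖ f∈S
            a′ : T′ ⋖[ f ] T
            a′ = removal-⋖ (⋖-⊆ s f∈S)
            b : U ⋖[ e ] T′
            b = ⋖-remove s (f≢e ∘ ≡.sym)
            y = hz U tt (⋖-size⁻ a p)
            z′ = z T′ tt (⋖-size⁺ b (⋖-size⁻ a p))

            by-activity : Dec (Active e U) →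
                          sign T′ f · Φ a′ z′ ⊕ σ · Φ s (F._*ₗ_ S (sign U f) (Φ a y)) ≈ᵀ F.0ᴹ T
            -- Here `U` is a lower member. By the square, `Φ s (Φ a y)` is `Φ a′ (Φ b y)`, and
            -- `Φ b y` is `z′` up to `sign U e`; the signs then cancel.
            by-activity (yes active′) = begin
              sign T′ f · Φ a′ z′ ⊕ σ · Φ s (F._*ₗ_ S (sign U f) (Φ a y))
                ≈⟨ F.+ᴹ-congˡ T (F.*ₗ-congˡ T (Φ.*ₗ-homo s (sign U f) (Φ a y))) ⟩
              sign T′ f · Φ a′ z′ ⊕ σ · sign U f · Φ s (Φ a y)
                ≈⟨ F.+ᴹ-congˡ T (F.*ₗ-congˡ T (F.*ₗ-congˡ T (F.≈ᴹ-trans T (square a s b a′ d y)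
                     (F.≈ᴹ-trans T (Φ.⟦⟧-cong a′ (homotopy-⋖ z b _ _
                       (inactiveBelow-⊆ (⋖-⊆ a) inactive) active′))
                       (Φ.*ₗ-homo a′ (sign U e) z′))))) ⟩
              sign T′ f · Φ a′ z′ ⊕ σ · sign U f · sign U e · Φ a′ z′
                ≈⟨ F.+ᴹ-congˡ T (F.*ₗ-congˡ T (F.*ₗ-assoc T (sign U f) (sign U e) _)) ⟨
              sign T′ f · Φ a′ z′ ⊕ σ · (sign U f * sign U e) · Φ a′ z′
                ≈⟨ F.+ᴹ-congˡ T (F.*ₗ-assoc T σ _ _) ⟨
              sign T′ f · Φ a′ z′ ⊕ (σ * (sign U f * sign U e)) · Φ a′ z′
                ≈⟨ F.*ₗ-distribʳ T _ _ _ ⟨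
              (sign T′ f + σ * (sign U f * sign U e)) · Φ a′ z′
                ≈⟨ F.*ₗ-congʳ T (sign-anticommute′ R (f≢e ∘ ≡.sym) a b) ⟩
              0# · Φ a′ z′
                ≈⟨ F.*ₗ-zeroˡ T _ ⟩
              F.0ᴹ T ∎
            -- Both terms vanish separately: `U` is no lower member, and no edge up to `e` is active
            -- in `T′`, so `z` is zero there.
            by-activity (no ¬active′) = F.≈ᴹ-trans T
              (F.+ᴹ-cong T
                (scaled-zero (sign T′ f) a′ (z-vanishes T′ inactive′ _))
                (scaled-zero σ s (scaled-zero (sign U f) a
                  (homotopy-0 z _ λ (_ , active′ , _) → ¬active′ active′))))
              (F.+ᴹ-identityʳ T _)
              where
              inactive′ : InactiveBelow (suc (toℕ e)) T′
              inactive′ = inactiveBelow-suc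
                (inactiveBelow-⊆ (⋖-⊆ a′) (inactiveBelow-⋖ s inactive))
                (¬active′ ∘ toggle b ℕₚ.≤-refl)

          total : Σ′.sum T t ⊕ σ · Φ s (Σ′.sum S u) ≈ᵀ σ · Φ s (z S tt p)
          total = begin
            Σ′.sum T t ⊕ σ · Φ s (Σ′.sum S u)
              ≈⟨ F.+ᴹ-congˡ T (scaled-sum σ s u) ⟩
            Σ′.sum T t ⊕ Σ′.sum T (λ f → σ · Φ s (u f))
              ≈⟨ Σ′.∑-distrib-+ T t (λ f → σ · Φ s (u f)) ⟨
            Σ′.sum T (λ f → t f ⊕ σ · Φ s (u f))
              ≈⟨ sum-single (F.+ᴹ-commutativeMonoid T) (λ f → t f ⊕ σ · Φ s (u f)) e
                   (λ f f≢e → cancel f f≢e (f ∈? S)) ⟩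
            t e ⊕ σ · Φ s (u e)
              ≈⟨ diagonal ⟩
            σ · Φ s (z S tt p) ∎

      cocycle≈δ-homotopy : ∀ S .(p : ∣ S ∣ ≡ suc k) → InactiveBelow (toℕ e) S →
                           F._≈ᴹ_ S (z S tt p) (δ-fun k d hz S tt p)
      cocycle≈δ-homotopy S p inactive with active? e S | e ∈? S
      ... | no ¬active | _       = inactive-case S p inactive ¬active
      ... | yes active | yes e∈S = member-case S p inactive active e∈S
      ... | yes active | no e∉S  = nonmember-case S p inactive active e∉S

  module _ {Q : Subset m → Set} (Q⇒inactive : ∀ {S} → Q S → ∀ e → ¬ Active e S) where

    homotopy-vanishes : ∀ e {k} (x : Cochain (suc k) d) → VanishesOn Q (homotopy e x)
    homotopy-vanishes e x S S∈Q p =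
      homotopy-0 e x p λ (_ , active , _) → Q⇒inactive S∈Q e active

    -- Subtracting δ of the homotopy for the edge with index j lowers the threshold from j + 1 to j.
    -- At threshold 0 the vanishing condition covers every set. The primitives vanish on `Q` because
    -- homotopies are supported where some edge is active.
    cocycle-vanishing⇒δ : ∀ j → j ℕ.≤ m → ∀ {k} (z : Cochain (suc k) d) →
      δ.fun z C.≈ᴹ C.0ᴹ → VanishesOn (InactiveBelow j) z →
      ∃ λ w → VanishesOn Q w × z C.≈ᴹ δ.fun w
    cocycle-vanishing⇒δ zero j≤m {k} z δz≈0 z-vanishes =
      C.0ᴹ , (λ S _ _ → F.≈ᴹ-refl S) ,
      λ S _ p → F.≈ᴹ-trans S (z-vanishes S (λ _ ()) p) (F.≈ᴹ-sym S (δ.0ᴹ-homo S tt p))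
    cocycle-vanishing⇒δ (suc j) j<m {k} z δz≈0 z-vanishes =
      let w , w-vanishes , z′≈δw = cocycle-vanishing⇒δ j (ℕₚ.<⇒≤ j<m) z′ δz′≈0 z′-vanishes in
      w C.+ᴹ hz ,
      (λ S S∈Q p → F.≈ᴹ-trans S (F.+ᴹ-cong S (w-vanishes S S∈Q p) (homotopy-vanishes e z S S∈Q p))
        (F.+ᴹ-identityˡ S _)) ,
      (begin
        z                                      ≈⟨ //-rightDividesˡ (δ.fun hz) z ⟨
        z′ C.+ᴹ δ.fun hz                       ≈⟨ C.+ᴹ-congʳ z′≈δw ⟩
        δ.fun w C.+ᴹ δ.fun hz                  ≈⟨ δ.+ᴹ-homo w hz ⟨
        δ.fun (w C.+ᴹ hz)                      ∎)
      where
      open SetoidReasoning (C.≈ᴹ-setoid {suc k})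
      open AbelianGroupProperties (C.+ᴹ-abelianGroup {suc k}) using (//-rightDividesˡ)
      e : Fin m
      e = fromℕ< j<m
      hz : Cochain k d
      hz = homotopy e z
      z′ : Cochain (suc k) d
      z′ = z C.+ᴹ C.-ᴹ δ.fun hz

      e≡j : toℕ e ≡ j
      e≡j = toℕ-fromℕ< j<m

      δz′≈0 : δ.fun z′ C.≈ᴹ C.0ᴹ
      δz′≈0 = δ-difference z hz δz≈0

      z′-vanishes : VanishesOn (InactiveBelow j) z′
      z′-vanishes S inactive p = F.≈ᴹ-trans S
        (F.+ᴹ-congʳ S (cocycle≈δ-homotopy e z δz≈0
          (subst (λ i → VanishesOn (InactiveBelow (suc i)) z) (≡.sym e≡j) z-vanishes)
          S p (subst (λ i → InactiveBelow i S) (≡.sym e≡j) inactive)))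
        (F.-ᴹ‿inverseʳ S _)

    cocycle-vanishing⇒0 : (z : Cochain zero d) → (∀ {S} → (∀ e → ¬ Active e S) → Q S) →
                          VanishesOn Q z → z C.≈ᴹ C.0ᴹ
    cocycle-vanishing⇒0 z inactive⇒Q z-vanishes S _ p = z-vanishes S
      (inactive⇒Q λ e active → contradiction-irr p (nonempty active)) p

-- Restriction of cochains to the ideal

module Restriction {R : CommutativeRing r ℓr} {m : ℕ} (F : CubeFunctor R m c ℓc)
                   (activity : Activity F) (Q : LowerOrderIdeal m)
                   (Q⇔inactive : ∀ S → LowerOrderIdeal.Member Q S ⇔
                                       (∀ e → ¬ Activity.Active activity e S))
                   (d : ℤ) where
  open Activity activity
  open CubeFunctor F
  open Cochains F wholeCube
  open CubeComplex F d
  open Matching F activity d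
  open LowerOrderIdeal Q renaming (Member to _∈Q)
  private
    module Q⇔ S = Equivalence (Q⇔inactive S)
    module Q = Cochains F Q
    module F S = Module (obj S d)
    module Σ′ S = Sums (F.+ᴹ-commutativeMonoid S)
    module C {k} = Module (cochains k d)
    module CQ {k} = Module (Q.cochains k d)
    module δ {k} = LinearMap (δ k d)
    module δQ {k} = LinearMap (Q.δ k d)

  -- Membership in `Q` becomes decidable through activity. Extension by zero needs the decision, and
  -- so does the recovery of a membership proof from an irrelevant one.
  _∈Q? : ∀ S → Dec (S ∈Q)
  S ∈Q? = map′ (Q⇔.from S) (Q⇔.to S) (Finₚ.all? λ e → ¬? (active? e S))

  restrict : ∀ {k} → Cochain k d → Q.Cochain k d
  restrict x S _ p = x S tt p

  -- Extension by zero need not commute with δ, so it only supplies a first approximation, which is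
  -- corrected afterwards by a cochain vanishing on `Q`.
  extend : ∀ {k} → Q.Cochain k d → Cochain k d
  extend {k} y S _ p = go (S ∈Q?)
    where
    go : Dec (S ∈Q) → F.Carrierᴹ S
    go (yes S∈Q) = y S S∈Q p
    go (no _)    = F.0ᴹ S

  restrict-extend : ∀ {k} (y : Q.Cochain k d) → restrict (extend y) CQ.≈ᴹ y
  restrict-extend y S S∈Q p with S ∈Q?
  ... | yes _  = F.≈ᴹ-refl S
  ... | no S∉Q = contradiction-irr S∈Q S∉Q

  -- As `Q` is closed downwards, every `T - e` with `T` in `Q` lies in `Q`, and both differentials
  -- have the same summands at `T`.
  restrict-δ : ∀ {k} (x : Cochain k d) → δQ.fun (restrict x) CQ.≈ᴹ restrict (δ.fun x)
  restrict-δ x T T∈Q q = Σ′.sum-cong-≋ T λ e → go e (e ∈? T)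
    where
    go : ∀ e e∈? → F._≈ᴹ_ T (Q.summand (restrict x) T T∈Q q e e∈?) (summand x T tt q e e∈?)
    go e (yes _) = F.≈ᴹ-refl T
    go e (no _)  = F.≈ᴹ-refl T

  restrict-0 : ∀ {k} {x : Cochain k d} → VanishesOn _∈Q x → restrict x CQ.≈ᴹ CQ.0ᴹ
  restrict-0 {x = x} x-vanishes S S∈Q p = x-vanishes S (recompute (S ∈Q?) S∈Q) p

  restrict-0⁻ : ∀ {k} {x : Cochain k d} → restrict x CQ.≈ᴹ CQ.0ᴹ → VanishesOn _∈Q x
  restrict-0⁻ rx≈0 S S∈Q p = rx≈0 S S∈Q p

  cocycle-vanishing⇒coboundary : ∀ {k} (z : Cochain (suc k) d) → δ.fun z C.≈ᴹ C.0ᴹ →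
    VanishesOn _∈Q z → ∃ λ w → VanishesOn _∈Q w × z C.≈ᴹ δ.fun w
  cocycle-vanishing⇒coboundary z δz≈0 z-vanishes =
    cocycle-vanishing⇒δ (λ {S} → Q⇔.to S) m ℕₚ.≤-refl z δz≈0
      λ S inactive → z-vanishes S (Q⇔.from S λ e → inactive e (toℕ<n e))

  private
    H : ℕ → Module R _ _
    H k = cohomology F wholeCube k d
    HQ : ℕ → Module R _ _
    HQ k = cohomology F Q k d
    module H {k} = Module (H k)
    module HQ {k} = Module (HQ k)

  coboundary-restrict : ∀ k {x : Cochain k d} → Submodule.Member (coboundaries k d) x →
                        Submodule.Member (Q.coboundaries k d) (restrict x)
  coboundary-restrict zero    (lift x≈0)     = lift λ S _ p → x≈0 S tt p
  coboundary-restrict (suc k) (w , x≈δw) =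
    restrict w , CQ.≈ᴹ-trans (λ S _ p → x≈δw S tt p) (CQ.≈ᴹ-sym (restrict-δ w))

  -- This is injectivity in cohomology. If `x` restricts to δ `v`, then `x` minus δ of the extension
  -- of `v` is a cocycle vanishing on `Q`, hence a coboundary.
  coboundary-restrict⁻ : ∀ k {x : Cochain k d} → δ.fun x C.≈ᴹ C.0ᴹ →
                         Submodule.Member (Q.coboundaries k d) (restrict x) →
                         Submodule.Member (coboundaries k d) x
  coboundary-restrict⁻ zero {x} δx≈0 (lift rx≈0) =
    lift (cocycle-vanishing⇒0 (λ {S} → Q⇔.to S) x (λ {S} → Q⇔.from S)
      (restrict-0⁻ {x = x} rx≈0))
  coboundary-restrict⁻ (suc k) {x} δx≈0 (v , rx≈δv) =
    let w , _ , z≈δw = cocycle-vanishing⇒coboundary z (δ-difference x v̄ δx≈0)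
                         (restrict-0⁻ {x = z} rz≈0)
    in w C.+ᴹ v̄ , C.≈ᴹ-trans (C.≈ᴹ-sym (//-rightDividesˡ (δ.fun v̄) x))
         (C.≈ᴹ-trans (C.+ᴹ-congʳ z≈δw) (C.≈ᴹ-sym (δ.+ᴹ-homo w v̄)))
    where
    open AbelianGroupProperties (C.+ᴹ-abelianGroup {suc k}) using (//-rightDividesˡ)
    v̄ = extend v
    z = x C.+ᴹ C.-ᴹ δ.fun v̄
    rz≈0 : restrict z CQ.≈ᴹ CQ.0ᴹ
    rz≈0 = begin
      restrict x CQ.+ᴹ CQ.-ᴹ restrict (δ.fun v̄)
        ≈⟨ CQ.+ᴹ-cong rx≈δv (CQ.-ᴹ‿cong (CQ.≈ᴹ-trans (CQ.≈ᴹ-sym (restrict-δ v̄))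
             (δQ.⟦⟧-cong (restrict-extend v)))) ⟩
      δQ.fun v CQ.+ᴹ CQ.-ᴹ δQ.fun v
        ≈⟨ CQ.-ᴹ‿inverseʳ (δQ.fun v) ⟩
      CQ.0ᴹ ∎
      where open SetoidReasoning (CQ.≈ᴹ-setoid {suc k})

  -- This is surjectivity in cohomology. With `ȳ` the extension of `y`, the cocycle δ `ȳ` vanishes
  -- on `Q`, so it is δ `w` with `w` vanishing on `Q`; then `ȳ` minus `w` is a cocycle that still
  -- restricts to `y`.
  lift-cocycle : ∀ k (y : Q.Cochain k d) → δQ.fun y CQ.≈ᴹ CQ.0ᴹ →
                 ∃ λ x → δ.fun x C.≈ᴹ C.0ᴹ × restrict x CQ.≈ᴹ y
  lift-cocycle k y δy≈0 =
    let w , w-vanishes , δȳ≈δw = cocycle-vanishing⇒coboundary (δ.fun ȳ)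
                                   (λ T _ q → δδ≈0 ȳ T q)
                                   (restrict-0⁻ {x = δ.fun ȳ} rδȳ≈0)
    in ȳ C.+ᴹ C.-ᴹ w
     , C.≈ᴹ-trans (δ.+ᴹ-homo ȳ (C.-ᴹ w))
         (C.≈ᴹ-trans (C.+ᴹ-cong δȳ≈δw (δ.-ᴹ-homo w)) (C.-ᴹ‿inverseʳ (δ.fun w)))
     , CQ.≈ᴹ-trans
         (CQ.+ᴹ-cong (restrict-extend y)
           (CQ.≈ᴹ-trans (CQ.-ᴹ‿cong (restrict-0 {x = w} w-vanishes)) ε⁻¹≈ε))
         (CQ.+ᴹ-identityʳ y)
    where
    open AbelianGroupProperties (CQ.+ᴹ-abelianGroup {k}) using (ε⁻¹≈ε)
    ȳ = extend y
    rδȳ≈0 : restrict (δ.fun ȳ) CQ.≈ᴹ CQ.0ᴹ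
    rδȳ≈0 = CQ.≈ᴹ-trans (CQ.≈ᴹ-sym (restrict-δ ȳ))
      (CQ.≈ᴹ-trans (δQ.⟦⟧-cong (restrict-extend y)) δy≈0)

  restrictᴴ : ∀ k → H.Carrierᴹ {k} → HQ.Carrierᴹ {k}
  restrictᴴ k (x , δx≈0) = restrict x , CQ.≈ᴹ-trans (restrict-δ x) (λ S _ p → δx≈0 S tt p)

  restrictᴴ-linear : ∀ k → LinearMap (H k) (HQ k)
  restrictᴴ-linear k = linearMap (H k) (HQ k) (restrictᴴ k)
    -- Equality of classes concerns the difference of representatives, and `restrict` commutes with
    -- differences definitionally.
    (λ {(x , _)} {(y , _)} → coboundary-restrict k {x C.+ᴹ C.-ᴹ y})
    (λ x y → HQ.≈ᴹ-refl {x = restrictᴴ k (x H.+ᴹ y)})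
    (λ s x → HQ.≈ᴹ-refl {x = restrictᴴ k (s H.*ₗ x)})

  cohomology-≅ : ∀ k → H k ≅ HQ k
  cohomology-≅ k = record
    { fun = restrictᴴ k
    ; isModuleIsomorphism = record
      { isModuleMonomorphism = record
        { isModuleHomomorphism = LinearMap.isModuleHomomorphism (restrictᴴ-linear k)
        ; injective = λ {(x , δx≈0)} {(y , δy≈0)} →
            coboundary-restrict⁻ k {x C.+ᴹ C.-ᴹ y}
              (Submodule.+-closed (kernel (δ k d)) δx≈0
                (Submodule.neg-closed (kernel (δ k d)) δy≈0))
        }
      ; surjective = λ (y , δy≈0) → let x , δx≈0 , rx≈y = lift-cocycle k y δy≈0 in
          (x , δx≈0) , λ {(x′ , δx′≈0)} x′∼x → Submodule.resp (Q.coboundaries k d)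
            (CQ.+ᴹ-congˡ (CQ.-ᴹ‿cong rx≈y)) (coboundary-restrict k x′∼x)
      }
    }

-- The maps of the chromatic functor

module _ {R : CommutativeRing r ℓr} (𝓐 : CommutativeGradedAlgebra R m ℓm) where
  open CommutativeGradedAlgebra 𝓐 using (component)
  open Products 𝓐

  module _ {k l} (f : Fin k → Fin l) (g : Fin l → Fin k)
           (f∘g : ∀ c′ → f (g c′) ≡ c′) (g∘f : ∀ c → g (f c) ≡ c)
           (φ : (Fin k → H) → Fin l → H) (φ≈ : ∀ a c′ → φ a c′ ≈ʰ fibreProduct f a c′) where
    private
      module F = AlongFibres f φ φ≈
      -- Each fibre of `g` is a single point, so the product over the fibre at `c` is `a (f c)`.
      module G = AlongFibres g (_∘ f) (λ a c → ≈ʰ-sym (fibreProduct-single g a (f c) (g∘f c)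
        λ c′ p → ≡.trans (≡.sym (f∘g c′)) (cong f p)))

      φ≈∘ : ∀ a c′ → φ a c′ ≈ʰ a (g c′)
      φ≈∘ a c′ = ≈ʰ-trans (φ≈ a c′) (fibreProduct-single f a (g c′) (f∘g c′)
        λ c p → ≡.trans (≡.sym (g∘f c)) (cong g p))

      ≡⇒≈ʰ : ∀ {x y : H} → x ≡ y → x ≈ʰ y
      ≡⇒≈ʰ refl = ≈ʰ-refl

      G∘F : ∀ {d} (x : Tensor component k d) → _≈ᵗ_ component (G.fun (F.fun x)) x
      G∘F (⨂ a p)  = ⨂-cong λ c → ≈ʰ-trans (φ≈∘ a (f c)) (≡⇒≈ʰ (cong a (g∘f c)))
      G∘F 0ᵗ       = ≈refl
      G∘F (x +ᵗ y) = +-cong (G∘F x) (G∘F y)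
      G∘F (-ᵗ x)   = neg-cong (G∘F x)
      G∘F (s *ᵗ x) = *-cong (CommutativeRing.refl R) (G∘F x)

      F∘G : ∀ {d} (y : Tensor component l d) → _≈ᵗ_ component (F.fun (G.fun y)) y
      F∘G (⨂ a p)  = ⨂-cong λ c′ → ≈ʰ-trans (φ≈∘ (a ∘ f) c′) (≡⇒≈ʰ (cong a (f∘g c′)))
      F∘G 0ᵗ       = ≈refl
      F∘G (x +ᵗ y) = +-cong (F∘G x) (F∘G y)
      F∘G (-ᵗ x)   = neg-cong (F∘G x)
      F∘G (s *ᵗ x) = *-cong (CommutativeRing.refl R) (F∘G x)

    -- Along a bijection nothing is multiplied: the map only renumbers the tensor factors, and
    -- renumbering by the inverse undoes it.
    alongFibres-bijective : ∀ {d} → Bijective (_≈ᵗ_ component) (_≈ᵗ_ component) (F.fun {d})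
    alongFibres-bijective =
      (λ {x} {y} Fx≈Fy → ≈trans (≈sym (G∘F x)) (≈trans (G.fun-cong Fx≈Fy) (G∘F y))) ,
      (λ y → G.fun y , λ x≈Gy → ≈trans (F.fun-cong x≈Gy) (F∘G y))

module _ (G : OrderedGraph) where
  open OrderedGraph G
  open Spanning ends

  -- Equivalently, S contains a broken circuit C ∖ {e}.
  EndsJoinedBelow : Fin edges → Subset edges → Set
  EndsJoinedBelow e S = Connected (S ∩ before e) (proj₁ (ends e)) (proj₂ (ends e))

  ends-distinct : ∀ e → proj₁ (ends e) ≢ proj₂ (ends e)
  ends-distinct e u≡v = ℕₚ.<⇒≢ (ends-increase e) (cong toℕ u≡v)

  endsJoinedBelow-nonempty : ∀ {e S} → EndsJoinedBelow e S → ∣ S ∣ ≢ 0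
  endsJoinedBelow-nonempty {e} {S} path ∣S∣≡0 = go refl refl path
    where
    -- The ends are generalised to variables so that the path can be split into cases.
    go : ∀ {x y} → x ≡ proj₁ (ends e) → y ≡ proj₂ (ends e) → ¬ Connected (S ∩ before e) x y
    go refl v≡ ε = ends-distinct e v≡
    go _ _ ((f , f∈ , _) ◅ _) = ℕₚ.n≮0 (subst (∣ S - f ∣ ℕ.<_) ∣S∣≡0
      (x∈p⇒∣p-x∣<∣p∣ (p∩q⊆p S (before e) f∈)))

  module _ {R : CommutativeRing r ℓr} (𝓐 : CommutativeGradedAlgebra R m ℓm) where
    private
      module K S = Quotient (components ends S)
      open Chromatic 𝓐 G

    -- The ends of `e` are already joined in `S`, so `S` and `T` have the same components and `into`
    -- and `back` are mutually inverse.
    chromaticMap-bijective : ∀ {e S T} → EndsJoinedBelow e S → (s : S ⋖[ e ] T) → ∀ d →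
      Bijective (_≈ᵗ_ _) (_≈ᵗ_ _) (LinearMap.fun (map e s d))
    chromaticMap-bijective {e} {S} {T} path s@(_ , T≡) d =
      alongFibres-bijective 𝓐 (into e s) (back e s) into-back back-into
        (factors e s) (factors≈fibreProduct e s)
      where
      into-back : ∀ c′ → into e s (back e s c′) ≡ c′
      into-back c′ = ≡.trans (into-class e s (K.rep T c′)) (K.class-rep T c′)

      near-u : ∀ {x} → Near T≡ x → Connected S x (proj₁ (ends e))
      near-u (inj₁ x~u) = x~u
      near-u (inj₂ x~v) = x~v ◅◅ connected-sym (connected-mono (p∩q⊆p S (before e)) path)

      unmerged : ∀ {x y} → Connected T x y → Connected S x y
      unmerged p with connected-∪⁻ T≡ p
      ... | inj₁ q       = q
      ... | inj₂ (a , b) = near-u a ◅◅ connected-sym (near-u b)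

      back-into : ∀ c → back e s (into e s c) ≡ c
      back-into c = ≡.trans
        (K.sound S (unmerged (K.complete T (K.class-rep T (into e s c)))))
        (K.class-rep S c)

    endsJoinedBelow-activity : Activity (chromaticFunctor 𝓐 G)
    endsJoinedBelow-activity = record
      { Active    = EndsJoinedBelow
      ; active?   = λ e S → map′ (K.complete (S ∩ before e)) (K.sound (S ∩ before e)) (_ ≟ _)
      ; mono      = λ {e} {S} S⊆T → connected-mono λ f∈ →
          let f∈S , f<e = x∈p∩q⁻ S (before e) f∈ in x∈p∩q⁺ (S⊆T f∈S , f<e)
      -- An edge that does not precede `e` lies outside `before e`, so `S ∩ before e` does not
      -- change.
      ; toggle    = λ {e} {f} s e≤f → subst (λ U → Connected U (proj₁ (ends e)) (proj₂ (ends e)))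
          (≡.sym (⋖-before-≮ {i = e} s (ℕₚ.≤⇒≯ e≤f)))
      ; nonempty  = endsJoinedBelow-nonempty
      ; bijective = chromaticMap-bijective
      }

-- Cycles and broken circuits

-- This is `next` of `IsCycle`, for an arbitrary positive length.
cyclicSuc : ∀ {n} → Fin (suc n) → Fin (suc n)
cyclicSuc {n} i = suc (toℕ i) mod suc n

toℕ-cyclicSuc : ∀ {n} (i : Fin (suc n)) → toℕ (cyclicSuc i) ≡ suc (toℕ i) % suc n
toℕ-cyclicSuc {n} i = toℕ-fromℕ< (m%n<n (suc (toℕ i)) (suc n))

cyclicSuc-inject₁ : ∀ {n} (i : Fin n) → cyclicSuc (inject₁ i) ≡ suc i
cyclicSuc-inject₁ {n} i = toℕ-injective (≡.trans (toℕ-cyclicSuc (inject₁ i))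
  (≡.trans (cong (λ k → suc k % suc n) (toℕ-inject₁ i)) (m<n⇒m%n≡m (ℕ.s≤s (toℕ<n i)))))

cyclicSuc-fromℕ : ∀ n → cyclicSuc (fromℕ n) ≡ zero
cyclicSuc-fromℕ n = toℕ-injective (≡.trans (toℕ-cyclicSuc (fromℕ n))
  (≡.trans (cong (λ k → suc k % suc n) (toℕ-fromℕ n)) (n%n≡0 (suc n))))

cyclicSuc-cases : ∀ {n} (i : Fin (suc n)) →
                  toℕ (cyclicSuc i) ≡ suc (toℕ i) ⊎ (toℕ i ≡ n × toℕ (cyclicSuc i) ≡ 0)
cyclicSuc-cases {n} i with view i
... | ‵inject₁ j = inj₁ (≡.trans (cong toℕ (cyclicSuc-inject₁ j))
  (cong suc (≡.sym (toℕ-inject₁ j))))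
... | ‵fromℕ     = inj₂ (toℕ-fromℕ n , cong toℕ (cyclicSuc-fromℕ n))

-- Here length at least 3 matters: it prevents a cycle from running along one edge and straight
-- back. The cases record which of the two steps wraps around.
cyclicSuc²-≢ : ∀ {n} (i : Fin (3 ℕ.+ n)) → cyclicSuc (cyclicSuc i) ≢ i
cyclicSuc²-≢ i eq with cyclicSuc-cases i | cyclicSuc-cases (cyclicSuc i) | cong toℕ eq
... | inj₁ p       | inj₁ q       | e with ≡.trans (≡.sym e) (≡.trans q (cong suc p))
...   | k = ℕₚ.m≢1+m+n _ {1} (≡.trans k (cong suc (≡.sym (ℕₚ.+-comm _ 1))))
cyclicSuc²-≢ i eq | inj₁ p       | inj₂ (q , z) | e with ≡.trans (≡.sym p) q | ≡.trans (≡.sym e) z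
... | a | b with ≡.trans (≡.sym (cong suc b)) a
...   | ()
cyclicSuc²-≢ i eq | inj₂ (p , z) | inj₁ q       | e
  with ≡.trans (≡.sym p) (≡.trans (≡.sym e) (≡.trans q (cong suc z)))
... | ()
cyclicSuc²-≢ i eq | inj₂ (_ , z) | inj₂ (q , _) | _ with ≡.trans (≡.sym z) q
... | ()

suc-% : ∀ k n → suc (k % suc n) % suc n ≡ suc k % suc n
suc-% k n = begin
  (1 ℕ.+ k % suc n) % suc n                       ≡⟨ %-distribˡ-+ 1 (k % suc n) (suc n) ⟩
  (1 % suc n ℕ.+ k % suc n % suc n) % suc n       ≡⟨ cong (λ l → (1 % suc n ℕ.+ l) % suc n)
                                                        (m%n%n≡m%n k (suc n)) ⟩
  (1 % suc n ℕ.+ k % suc n) % suc n               ≡⟨ %-distribˡ-+ 1 k (suc n) ⟨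
  (1 ℕ.+ k) % suc n                               ∎
  where open ≡.≡-Reasoning

toℕ-fold-cyclicSuc : ∀ {n} (i : Fin (suc n)) k → toℕ (fold i cyclicSuc k) ≡ (k ℕ.+ toℕ i) % suc n
toℕ-fold-cyclicSuc i zero = ≡.sym (m<n⇒m%n≡m (toℕ<n i))
toℕ-fold-cyclicSuc {n} i (suc k) = ≡.trans (toℕ-cyclicSuc (fold i cyclicSuc k))
  (≡.trans (cong (λ l → suc l % suc n) (toℕ-fold-cyclicSuc i k)) (suc-% (k ℕ.+ toℕ i) n))

fold-cyclicSuc : ∀ {n} (i : Fin (suc n)) → fold i cyclicSuc (suc n) ≡ i
fold-cyclicSuc {n} i = toℕ-injective (≡.trans (toℕ-fold-cyclicSuc i (suc n))
  (≡.trans (cong (_% suc n) (ℕₚ.+-comm (suc n) (toℕ i)))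
    (≡.trans ([m+n]%n≡m%n (toℕ i) (suc n)) (m<n⇒m%n≡m (toℕ<n i)))))

module _ (G : OrderedGraph) where
  open OrderedGraph G
  open Spanning ends

  Visits : ∀ {S x y} → Fin vertices → Connected S x y → Set
  Visits {y = y} z ε             = z ≡ y
  Visits z (_◅_ {x} _ p)         = z ≡ x ⊎ Visits z p

  visits? : ∀ {S x y} z (p : Connected S x y) → Dec (Visits z p)
  visits? {y = y} z ε     = z ≟ y
  visits? z (_◅_ {x} _ p) with z ≟ x | visits? z p
  ... | yes z≡x | _       = yes (inj₁ z≡x)
  ... | no _    | yes z∈p = yes (inj₂ z∈p)
  ... | no z≢x  | no z∉p  = no [ z≢x , z∉p ]′

  Simple : ∀ {S x y} → Connected S x y → Set
  Simple ε             = ⊤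
  Simple (_◅_ {x} _ p) = ¬ Visits x p × Simple p

  simple-suffix : ∀ {S x y z} (p : Connected S x y) → Simple p → Visits z p →
                  ∃ λ (q : Connected S z y) → Simple q
  simple-suffix ε       _            refl        = ε , tt
  simple-suffix (s ◅ p) simple       (inj₁ refl) = s ◅ p , simple
  simple-suffix (s ◅ p) (_ , simple) (inj₂ z∈p)  = simple-suffix p simple z∈p

  -- If the simplified tail returns to the first vertex, the detour before that return is cut off.
  simplify : ∀ {S x y} → Connected S x y → ∃ λ (p : Connected S x y) → Simple p
  simplify ε = ε , tt
  simplify (_◅_ {x} s p) with simplify p
  ... | q , simple with visits? x q
  ...   | yes x∈q = simple-suffix q simple x∈q
  ...   | no x∉q  = s ◅ q , x∉q , simple

  length : ∀ {S x y} → Connected S x y → ℕ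
  length ε       = 0
  length (_ ◅ p) = suc (length p)

  vertex : ∀ {S x y} (p : Connected S x y) → Fin (suc (length p)) → Fin vertices
  vertex {y = y} ε     zero    = y
  vertex (_◅_ {x} _ p) zero    = x
  vertex (_ ◅ p)       (suc i) = vertex p i

  -- The edges of p, followed by an edge e which leads back from the end of p to its start.
  closedEdge : ∀ {S x y} (p : Connected S x y) → Fin edges → Fin (suc (length p)) → Fin edges
  closedEdge ε             e zero    = e
  closedEdge ((f , _) ◅ p) e zero    = f
  closedEdge (_ ◅ p)       e (suc i) = closedEdge p e i

  vertex-zero : ∀ {S x y} (p : Connected S x y) → vertex p zero ≡ x
  vertex-zero ε       = refl
  vertex-zero (_ ◅ p) = refl

  vertex-visits : ∀ {S x y} (p : Connected S x y) i → Visits (vertex p i) p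
  vertex-visits ε       zero    = refl
  vertex-visits (_ ◅ p) zero    = inj₁ refl
  vertex-visits (_ ◅ p) (suc i) = inj₂ (vertex-visits p i)

  vertex-injective : ∀ {S x y} (p : Connected S x y) → Simple p → Injective _≡_ _≡_ (vertex p)
  vertex-injective ε       _ {zero} {zero} _ = refl
  vertex-injective (_ ◅ p) _ {zero} {zero} _ = refl
  vertex-injective (_ ◅ p) (x∉p , _) {zero} {suc j} x≡ =
    contradiction (subst (λ z → Visits z p) (≡.sym x≡) (vertex-visits p j)) x∉p
  vertex-injective (_ ◅ p) (x∉p , _) {suc i} {zero} ≡x =
    contradiction (subst (λ z → Visits z p) ≡x (vertex-visits p i)) x∉p
  vertex-injective (_ ◅ p) (_ , simple) {suc i} {suc j} eq = cong suc (vertex-injective p simple eq)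

  closedEdge-joins : ∀ {S x y} (p : Connected S x y) e (i : Fin (length p)) →
                     Joins (closedEdge p e (inject₁ i)) (vertex p (inject₁ i)) (vertex p (suc i))
  closedEdge-joins ((f , _ , j) ◅ p) e zero    = subst (Joins f _) (≡.sym (vertex-zero p)) j
  closedEdge-joins (_ ◅ p)           e (suc i) = closedEdge-joins p e i

  closedEdge-last : ∀ {S x y} (p : Connected S x y) e → closedEdge p e (fromℕ (length p)) ≡ e
  closedEdge-last ε       e = refl
  closedEdge-last (_ ◅ p) e = closedEdge-last p e

  vertex-last : ∀ {S x y} (p : Connected S x y) → vertex p (fromℕ (length p)) ≡ y
  vertex-last ε       = refl
  vertex-last (_ ◅ p) = vertex-last p

  closedEdge-∈ : ∀ {S x y} (p : Connected S x y) e i → closedEdge p e i ≡ e ⊎ closedEdge p e i ∈ S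
  closedEdge-∈ ε                 e zero    = inj₁ refl
  closedEdge-∈ ((_ , f∈S , _) ◅ p) e zero  = inj₂ f∈S
  closedEdge-∈ (_ ◅ p)           e (suc i) = closedEdge-∈ p e i

  joins-increase : ∀ {e x y} → ends e ≡ (x , y) → x Fin.< y
  joins-increase {e} p = subst (λ (x , y) → x Fin.< y) p (ends-increase e)

  -- Ends are stored in increasing order, which rules out opposite orientations; otherwise
  -- injectivity of `ends` applies.
  joins-unique : ∀ {e f x y} → Joins e x y → Joins f x y → e ≡ f
  joins-unique (inj₁ p) (inj₁ q) = ends-injective (≡.trans p (≡.sym q))
  joins-unique (inj₂ p) (inj₂ q) = ends-injective (≡.trans p (≡.sym q))
  joins-unique (inj₁ p) (inj₂ q) = contradiction (joins-increase q) (ℕₚ.<-asym (joins-increase p))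
  joins-unique (inj₂ p) (inj₁ q) = contradiction (joins-increase q) (ℕₚ.<-asym (joins-increase p))

  joins-ends : ∀ {e a b a′ b′} → Joins e a b → Joins e a′ b′ → a ≡ a′ ⊎ (a ≡ b′ × b ≡ a′)
  joins-ends (inj₁ p) (inj₁ q) = inj₁ (,-injectiveˡ (≡.trans (≡.sym p) q))
  joins-ends (inj₂ p) (inj₂ q) = inj₁ (,-injectiveʳ (≡.trans (≡.sym p) q))
  joins-ends (inj₁ p) (inj₂ q) = inj₂ (,-injective (≡.trans (≡.sym p) q))
  joins-ends (inj₂ p) (inj₁ q) = inj₂ (Product.swap (,-injective (≡.trans (≡.sym p) q)))

  -- A simple path among earlier edges of `S`, closed up by `e`, is a cycle with largest edge `e`;
  -- without `e` it is a broken circuit inside `S`.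
  endsJoinedBelow⇒¬NBC : ∀ {e S} → EndsJoinedBelow G e S → ¬ LowerOrderIdeal.Member (NBC G) S
  endsJoinedBelow⇒¬NBC {e} {S} path nbc = go refl refl (simplify path)
    where
    go : ∀ {u v} → u ≡ proj₁ (ends e) → v ≡ proj₂ (ends e) →
         ¬ (∃ λ (p : Connected (S ∩ before e) u v) → Simple p)
    go refl v≡ (ε , _) = ends-distinct G e v≡
    -- A path of length one would be an edge with the ends of `e`, hence `e` itself, which does not
    -- precede itself. So the closed sequence has length at least 3.
    go refl refl ((f , f∈ , j) ◅ ε , _) = contradiction (joins-unique j (inj₁ refl)) λ { refl →
      ℕₚ.<-irrefl refl (∈-before⁻ (proj₂ (x∈p∩q⁻ S (before e) f∈))) }
    go refl refl (p@(_ ◅ _ ◅ q) , simple) =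
      nbc (C - e) (C , e , isCycle , edge-∈ (fromℕ _) (closedEdge-last p e) , max , refl) C-e⊆S
      where
      edge = closedEdge p e

      inC? : ∀ f → Dec (∃ λ i → edge i ≡ f)
      inC? f = Finₚ.any? λ i → edge i ≟ f

      C : Subset edges
      C = tabulate (does ∘ inC?)

      edge-∈ : ∀ {f} i → edge i ≡ f → f ∈ C
      edge-∈ i p = ∈-tabulate⁺ inC? (i , p)

      joins : ∀ i → Joins (edge i) (vertex p i) (vertex p (cyclicSuc i))
      joins i with view i
      ... | ‵inject₁ j = subst (Joins _ _) (cong (vertex p) (≡.sym (cyclicSuc-inject₁ j)))
        (closedEdge-joins p e j)
      -- The closing edge is traversed from its second end, the last vertex of the path, to its
      -- first.
      ... | ‵fromℕ     = inj₂ (≡.trans (cong ends (closedEdge-last p e))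
        (≡.sym (≡.cong₂ _,_ (cong (vertex p) (cyclicSuc-fromℕ (2 ℕ.+ length q))) (vertex-last p))))

      isCycle : IsCycle G C
      isCycle = record
        { extra    = length q
        ; x        = vertex p
        ; distinct = vertex-injective p simple
        ; edge     = edge
        ; joins    = joins
        ; edge-set = λ f → mk⇔ (∈-tabulate⁻ inC?) (∈-tabulate⁺ inC?)
        }

      ∈C-cases : ∀ {f} → f ∈ C → f ≡ e ⊎ f ∈ S ∩ before e
      ∈C-cases f∈C with ∈-tabulate⁻ inC? f∈C
      ... | i , refl = closedEdge-∈ p e i

      max : ∀ f → f ∈ C → f Fin.≤ e
      max f f∈C with ∈C-cases f∈C
      ... | inj₁ refl = ℕₚ.≤-refl
      ... | inj₂ f∈   = ℕₚ.<⇒≤ (∈-before⁻ (proj₂ (x∈p∩q⁻ S (before e) f∈)))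

      C-e⊆S : C - e ⊆ S
      C-e⊆S f∈ with ∈C-cases (p─q⊆p C ⁅ e ⁆ f∈)
      ... | inj₁ f≡e = contradiction f≡e (x∈p-y⇒x≢y f∈)
      ... | inj₂ f∈S = p∩q⊆p S (before e) f∈S

  module _ {C : Subset edges} (cycle : IsCycle G C) where
    open IsCycle cycle

    -- Equal edges have equal ends. In the same orientation the indices agree; in opposite
    -- orientations two steps would lead from `i` back to `i`.
    edge-injective : Injective _≡_ _≡_ edge
    edge-injective {i} {j} p with joins-ends (subst (λ f → Joins f _ _) p (joins i)) (joins j)
    ... | inj₁ xi≡xj          = distinct xi≡xj
    ... | inj₂ (xi≡ , xnexti≡) = contradiction
      (≡.trans (cong cyclicSuc (distinct xnexti≡)) (≡.sym (distinct xi≡))) (cyclicSuc²-≢ i)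

    round : ∀ {T} i₀ → (∀ i → i ≢ i₀ → edge i ∈ T) → Connected T (x (next i₀)) (x i₀)
    round {T} i₀ ∈T = [ id , subst (λ i → Connected T (x (next i₀)) (x i)) (fold-cyclicSuc i₀) ]′
      (go (2 ℕ.+ extra))
      where
      -- The left alternative stops the walk as soon as it meets `i₀`, so the intermediate indices
      -- need not be shown different from `i₀`. After `len` steps in all the index is `i₀` again.
      go : ∀ n → Connected T (x (next i₀)) (x i₀) ⊎
                 Connected T (x (next i₀)) (x (fold i₀ cyclicSuc (suc n)))
      go zero = inj₂ ε
      go (suc n) with go n
      ... | inj₁ p = inj₁ p
      ... | inj₂ p with fold i₀ cyclicSuc (suc n)
      ...   | i with i ≟ i₀
      ...     | yes refl = inj₁ p
      ...     | no i≢i₀  = inj₂ (p ◅◅ (edge i , ∈T i i≢i₀ , joins i) ◅ ε)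

  -- The other edges of the cycle differ from its largest edge `e`, hence precede it, and going
  -- round them joins the ends of `e`.
  brokenCircuit⇒endsJoinedBelow : ∀ {B S} → IsBrokenCircuit G B → B ⊆ S →
                                  ∃ λ e → EndsJoinedBelow G e S
  brokenCircuit⇒endsJoinedBelow {S = S} (C , e , cycle , e∈C , max , refl) C-e⊆S
    with Equivalence.to (IsCycle.edge-set cycle e) e∈C
  ... | i₀ , refl = e , oriented (joins i₀)
      (round cycle i₀ λ i i≢i₀ → x∈p∩q⁺
        ( C-e⊆S (x∈p∧x≢y⇒x∈p-y (edge-∈ i) (i≢i₀ ∘ edge-injective cycle))
        , ∈-before⁺ (ℕₚ.≤∧≢⇒< (max (edge i) (edge-∈ i))
            (i≢i₀ ∘ edge-injective cycle ∘ toℕ-injective)) ))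
    where
    open IsCycle cycle
    edge-∈ : ∀ i → edge i ∈ C
    edge-∈ i = Equivalence.from (edge-set (edge i)) (i , refl)

    oriented : ∀ {a b} → Joins e a b → Connected (S ∩ before e) b a → EndsJoinedBelow G e S
    oriented (inj₁ refl) p = connected-sym p
    oriented (inj₂ refl) p = p

  NBC⇔ : ∀ S → LowerOrderIdeal.Member (NBC G) S ⇔ (∀ e → ¬ EndsJoinedBelow G e S)
  NBC⇔ S = mk⇔
    (λ nbc e path → endsJoinedBelow⇒¬NBC path nbc)
    (λ inactive B broken B⊆S →
      let e , path = brokenCircuit⇒endsJoinedBelow broken B⊆S in inactive e path)

theorem5p9 : ∀ {r ℓr m ℓm : Level} (R : CommutativeRing r ℓr)
    (𝓐 : CommutativeGradedAlgebra R m ℓm) →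
    (∀ i → IsFreeOfFiniteRank (CommutativeGradedAlgebra.component 𝓐 i)) →
    (G : OrderedGraph) (k : ℕ) →
    cohomology (chromaticFunctor 𝓐 G) wholeCube k ≅ᵍ cohomology (chromaticFunctor 𝓐 G) (NBC G) k
theorem5p9 R 𝓐 _ G k d =
  Restriction.cohomology-≅ (chromaticFunctor 𝓐 G) (endsJoinedBelow-activity G 𝓐)
    (NBC G) (NBC⇔ G) d k
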